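{- Let $n$ and $\sigma$ be integers with $8 \leq \sigma \leq n$. There is no deterministic algorithm that performs at most $n \ln \sigma - 3.6n$ equality comparisons in the worst case and correctly determines, for every length-$n$ string with at most $\sigma$ distinct symbols from a general unordered alphabet, whether that string is square-free.
   Context: General unordered alphabet: the algorithm can access the input string $T[1..n]$ only through queries "is $T[i]=T[j]$?" for positions $i,j$; each such query counts as one comparison. No order on the symbols is available. A square is a fragment $T[s..s+2\ell-1]$ with $\ell \geq 1$ and $T[s..s+\ell-1]=T[s+\ell..s+2\ell-1]$; a string is square-free if it contains no square. $\ln$ denotes the natural logarithm. -}

module Defs where

open import Data.Nat using (ℕ; zero; suc; _+_; _*_; _^_; _≤_; _⊔_)
open import Data.Nat.Base using (_!)
open import Data.Fin using (Fin)
open import Data.Fin.Properties using (_≟_)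
open import Data.Vec using (Vec; lookup; toList)
open import Data.List using (List; []; _++_)
open import Data.Bool using (Bool; true; false)
open import Data.Product using (Σ; _×_; ∃; ∃-syntax)
open import Relation.Nullary using (¬_; Dec; yes; no)
open import Relation.Binary.PropositionalEquality using (_≡_; _≢_)
open import Function.Bundles using (_⇔_)

HasSquare : {A : Set} → List A → Set
HasSquare {A} xs =
  Σ (List A) λ u → Σ (List A) λ v → Σ (List A) λ w →
    (v ≢ []) × (xs ≡ u ++ v ++ v ++ w)

SquareFree : {A : Set} → List A → Set
SquareFree xs = ¬ HasSquare xs

-- Deterministic comparison-based algorithms on length-n strings:
-- decision trees whose internal nodes ask "is T[i] = T[j] ?" and whose
-- leaves output an answer (true = "square-free").

data DecTree (n : ℕ) : Set where
  leaf : Bool → DecTree n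
  ask  : Fin n → Fin n → (ifEq ifNeq : DecTree n) → DecTree n

depth : {n : ℕ} → DecTree n → ℕ
depth (leaf _)      = 0
depth (ask _ _ t f) = suc (depth t ⊔ depth f)

run : {n σ : ℕ} → DecTree n → Vec (Fin σ) n → Bool
run (leaf b) T = b
run (ask i j t f) T with lookup T i ≟ lookup T j
... | yes _ = run t T
... | no  _ = run f T

-- D correctly decides square-freeness of every length-n string with at
-- most σ distinct symbols (WLOG the symbols are drawn from Fin σ).
DecidesSquareFreeness : (n σ : ℕ) → DecTree n → Set
DecidesSquareFreeness n σ D =
  (T : Vec (Fin σ) n) → (run D T ≡ true) ⇔ SquareFree (toList T)

-- The real inequality  q ≤ n ln σ − 3.6 n  without real numbers.
-- It is equivalent to  exp(q + 3.6 n) ≤ σ^n, i.e. exp(m/5) ≤ σ^n with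
-- m = 5q + 18n.  Since the partial sums S_k = Σ_{j≤k} (m/5)^j / j!
-- increase to exp(m/5), this holds iff S_k ≤ σ^n for all k.
-- expScaled m k = 5^k · k! · S_k, which satisfies
--   expScaled m 0 = 1,  expScaled m (k+1) = 5 (k+1) expScaled m k + m^(k+1).

expScaled : ℕ → ℕ → ℕ
expScaled m zero    = 1
expScaled m (suc k) = 5 * suc k * expScaled m k + m ^ suc k

WithinBound : (n σ q : ℕ) → Set
WithinBound n σ q =
  (k : ℕ) → expScaled (5 * q + 18 * n) k ≤ (σ ^ n) * (5 ^ k) * (k !)

{-# OPTIONS --safe #-}
-- Adversary argument. A position is committed to a symbol only when it has taken part in 4 L unequal
-- comparisons, with 16 L + 4 ≤ σ; until then every comparison with it is answered "different". The
-- symbols are split into four groups and position x is committed to a symbol of the group prescribed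
-- by a square-free word over four letters, so some completion is square-free. On the other hand, if
-- for some ℓ ≤ L and some pair of adjacent aligned blocks of length ℓ all 2 ℓ positions are
-- uncommitted and no pair at distance ℓ across them was compared, then the two blocks can be made
-- equal without contradicting any answer. So each of the Σ (⌊n/ℓ⌋ − 1) block pairs with ℓ ≤ L must be
-- spoiled, by a comparison or by a committed position; a committed position lies in at most 2 L of
-- them and accounts for 4 L half comparisons. Hence at least Σ (⌊n/ℓ⌋ − 1) comparisons are made.
-- With exp (1/ℓ) ≥ (ℓ + 1)/ℓ and σ < 20 (L + 1) < exp 3.1 · (L + 1) this exceeds n ln σ − 3.6 n; the
-- remaining n/2 covers the rounding loss of at most 2 L.
module Submission where

open import Defs
open import Data.Nat
open import Data.Nat.Properties
open import Data.Nat.Divisibility using (_∣_; ∣-trans; m≤n⇒m!∣n!; divides; ∣m⇒∣m*n; ∣n⇒∣m*n)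
open import Data.Nat.DivMod using (m≡m%n+[m/n]*n; m%n<n; m/n*n≤m; m*n/n≡m; /-monoˡ-≤; m<n*o⇒m/o<n; [m+kn]%n≡m%n; m<n⇒m%n≡m)
open import Data.Nat.Induction using (<-rec)
open import Data.Nat.Tactic.RingSolver using (solve-∀)
open import Data.Bool using (Bool; true; false; not; _xor_)
open import Data.Bool.Properties using (not-injective; not-involutive; not-¬; ¬-not) renaming (_≟_ to _≟ᵇ_)
open import Data.Fin using (Fin; toℕ; fromℕ<)
open import Data.Fin.Properties using (toℕ<n; toℕ-injective; toℕ-fromℕ<; injective⇒≤; any?) renaming (_≟_ to _≟ᶠ_)
open import Data.Vec using (Vec; toList; tabulate) renaming (lookup to lookupᵛ)
open import Data.Vec.Properties using (lookup∘tabulate)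
open import Data.List using (List; []; _∷_; _++_; length; map; filter; upTo; applyUpTo; cartesianProduct; lookup)
open import Data.List.Properties using (∷-injective; length-map; length-++; length-filter; length-upTo)
open import Data.List.Membership.DecPropositional using (_∈?_)
open import Data.List.Membership.Propositional using (_∈_; _∉_)
open import Data.List.Membership.Propositional.Properties
open import Data.List.Relation.Unary.All as All using (All)
open import Data.List.Relation.Unary.AllPairs using ([]; _∷_)
open import Data.List.Relation.Unary.Any using (here; there; index)
open import Data.List.Relation.Unary.Any.Properties using (lookup-index)
open import Data.List.Relation.Unary.Unique.Propositional using (Unique)
import Data.List.Relation.Unary.Unique.Propositional.Properties as Unique
open import Data.Product using (∃; _×_; _,_; proj₁; proj₂)
open import Data.Product.Properties using (,-injectiveʳ) renaming (≡-dec to ×-≡-dec)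
open import Data.Sum using (_⊎_; inj₁; inj₂; [_,_]′)
open import Data.Sum.Properties using (inj₁-injective; inj₂-injective) renaming (≡-dec to ⊎-≡-dec)
open import Data.Unit using (⊤; tt)
open import Data.Empty using (⊥; ⊥-elim)
open import Function using (_∘_; id; Injective; Equivalence)
open import Relation.Nullary using (¬_; yes; no; ¬?; contradiction)
open import Relation.Nullary.Decidable using (decidable-stable; toWitness; _×-dec_)
open import Relation.Unary using (Decidable)
open import Relation.Binary.Definitions using (DecidableEquality)
open import Relation.Binary.PropositionalEquality

-- Truncated exponentials

-- This is c^k k! times the k-th partial sum of exp (m / c). The denominator is free because the
-- increments 1/ℓ need a common one.
expS : ℕ → ℕ → ℕ → ℕ
expS c m zero    = 1
expS c m (suc k) = c * suc k * expS c m k + m ^ suc k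

expScaled≡expS : ∀ m k → expScaled m k ≡ expS 5 m k
expScaled≡expS m zero    = refl
expScaled≡expS m (suc k) = cong (λ e → 5 * suc k * e + m ^ suc k) (expScaled≡expS m k)

^-distribʳ-* : ∀ a b n → (a * b) ^ n ≡ a ^ n * b ^ n
^-distribʳ-* a b zero    = refl
^-distribʳ-* a b (suc n) =
  trans (cong (a * b *_) (^-distribʳ-* a b n)) (swap a b (a ^ n) (b ^ n))
  where
  swap : ∀ a b x y → a * b * (x * y) ≡ a * x * (b * y)
  swap = solve-∀

-- The exponent m / c is unchanged; only the cleared denominator grows.
expS-scale : ∀ t c m k → expS (t * c) (t * m) k ≡ t ^ k * expS c m k
expS-scale t c m zero    = refl
expS-scale t c m (suc k)
  rewrite expS-scale t c m k | ^-distribʳ-* t m k =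
  rearrange t c m (suc k) (t ^ k) (expS c m k) (m ^ k)
  where
  rearrange : ∀ t c m j x e y →
    t * c * j * (x * e) + t * m * (x * y) ≡ t * x * (c * j * e + m * y)
  rearrange = solve-∀

expS-mono : ∀ c k {m m′} → m ≤ m′ → expS c m k ≤ expS c m′ k
expS-mono c zero    m≤m′ = ≤-refl
expS-mono c (suc k) m≤m′ =
  +-mono-≤ (*-monoʳ-≤ (c * suc k) (expS-mono c k m≤m′)) (^-monoˡ-≤ (suc k) m≤m′)

-- The first two binomial terms; the induction discards the one with y².
bernoulli : ∀ m y k → m ^ suc k + suc k * y * m ^ k ≤ (m + y) ^ suc k
bernoulli m y zero    = ≤-reflexive (base m y)
  where
  base : ∀ m y → m * 1 + 1 * y * 1 ≡ (m + y) * 1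
  base = solve-∀
bernoulli m y (suc k) = begin
  m * (m * M) + (2 + k) * y * (m * M)            ≤⟨ m≤m+n _ _ ⟩
  m * (m * M) + (2 + k) * y * (m * M) + (1 + k) * (y * y) * M ≡⟨ rearrange m y k M ⟩
  (m + y) * (m * M + (1 + k) * y * M)            ≤⟨ *-monoʳ-≤ (m + y) (bernoulli m y k) ⟩
  (m + y) * ((m + y) ^ suc k)                    ∎
  where
  open ≤-Reasoning
  M = m ^ k
  rearrange : ∀ m y k M → m * (m * M) + (2 + k) * y * (m * M) + (1 + k) * (y * y) * M
                          ≡ (m + y) * (m * M + (1 + k) * y * M)
  rearrange = solve-∀

-- For the partial sums S of the exponential series, with a = m / c and b = y / c, this reads
-- S_{k+1}(a + b) ≥ S_{k+1}(a) + b S_k(a). It follows termwise from `bernoulli`.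
expS-+ : ∀ c m y k → expS c m (suc k) + suc k * y * expS c m k ≤ expS c (m + y) (suc k)
expS-+ c m y zero    = ≤-reflexive (base c m y)
  where
  base : ∀ c m y → c * 1 * 1 + m * 1 + 1 * y * 1 ≡ c * 1 * 1 + (m + y) * 1
  base = solve-∀
expS-+ c m y (suc k) = begin
  c * (2 + k) * (c * (1 + k) * X + M) + m * M + (2 + k) * y * (c * (1 + k) * X + M)
    ≡⟨ rearrange c m y k X M ⟩
  c * (2 + k) * (c * (1 + k) * X + M + (1 + k) * y * X) + (m * M + (2 + k) * y * M)
    ≤⟨ +-mono-≤ (*-monoʳ-≤ (c * (2 + k)) (expS-+ c m y k)) (bernoulli m y (suc k)) ⟩
  c * (2 + k) * expS c (m + y) (suc k) + (m + y) ^ (2 + k) ∎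
  where
  open ≤-Reasoning
  X = expS c m k
  M = m ^ suc k
  rearrange : ∀ c m y k X M →
    c * (2 + k) * (c * (1 + k) * X + M) + m * M + (2 + k) * y * (c * (1 + k) * X + M)
    ≡ c * (2 + k) * (c * (1 + k) * X + M + (1 + k) * y * X) + (m * M + (2 + k) * y * M)
  rearrange = solve-∀

-- P / c ^ k is at most the k-th partial sum of exp (m / c).
record PartialExp≥ (c m k P : ℕ) : Set where
  constructor mk
  field bound : P * k ! ≤ expS c m k

-- exp (y / c) ≥ (c + y) / c
partialExp-step : ∀ {c m k P} y → PartialExp≥ c m k P → PartialExp≥ c (m + y) (suc k) ((c + y) * P)
partialExp-step {c} {m} {k} {P} y (mk h) = mk (begin
  (c + y) * P * (k ! + k * k !)              ≡⟨ rearrange c y P k (k !) ⟩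
  (c * suc k + suc k * y) * (P * k !)        ≤⟨ *-monoʳ-≤ (c * suc k + suc k * y) h ⟩
  (c * suc k + suc k * y) * X                ≡⟨ *-distribʳ-+ X (c * suc k) (suc k * y) ⟩
  c * suc k * X + suc k * y * X              ≤⟨ +-monoˡ-≤ (suc k * y * X) (m≤m+n (c * suc k * X) (m ^ suc k)) ⟩
  expS c m (suc k) + suc k * y * X           ≤⟨ expS-+ c m y k ⟩
  expS c (m + y) (suc k)                     ∎)
  where
  open ≤-Reasoning
  X = expS c m k
  rearrange : ∀ c y P k f → (c + y) * P * (f + k * f) ≡ (c * suc k + suc k * y) * (P * f)
  rearrange = solve-∀

partialExp-steps : ∀ {c m k P} j y → PartialExp≥ c m k P →
                   PartialExp≥ c (j * y + m) (j + k) ((c + y) ^ j * P)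
partialExp-steps {c} {m} {k} {P} zero    y h = subst (λ p → PartialExp≥ c m k p) (sym (*-identityˡ P)) h
partialExp-steps {c} {m} {k} {P} (suc j) y h =
  subst₂ (λ m p → PartialExp≥ c m (suc j + k) p) (sum y (j * y) m)
    (sym (*-assoc (c + y) ((c + y) ^ j) P))
    (partialExp-step y (partialExp-steps j y h))
  where
  sum : ∀ y a m → a + m + y ≡ y + a + m
  sum = solve-∀

-- The summation index k stands for the length ℓ = 1 + k.
Σ[ℓ<_] : ℕ → (ℕ → ℕ) → ℕ
Σ[ℓ< zero ]  f = 0
Σ[ℓ< suc L ] f = Σ[ℓ< L ] f + f L

-- The product of (ℓ + 1) / ℓ for ℓ ≤ L telescopes to L + 1.
partialExp-harmonic : ∀ n c L → (∀ ℓ → ℓ < L → suc ℓ ∣ c) →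
  ∃ λ m → m ≤ c * Σ[ℓ< L ] (λ ℓ → suc (n / suc ℓ)) ×
          PartialExp≥ c m (L * n) ((c ^ L * suc L) ^ n)
partialExp-harmonic n c zero    div = 0 , z≤n , mk (≤-reflexive (trans (*-identityʳ _) (^-zeroˡ n)))
-- With y = c / ℓ, each of `n` increments of the exponent by 1/ℓ gains the factor 1 + 1/ℓ; their
-- total n/ℓ is then rounded up to an integer.
partialExp-harmonic n c (suc L) div
  with m , m≤ , h ← partialExp-harmonic n c L (λ ℓ ℓ<L → div ℓ (m≤n⇒m≤1+n ℓ<L))
     | divides y c≡y*ℓ ← div L ≤-refl = n * y + m , bound , reach
  where
  open ≤-Reasoning
  ℓ = suc L
  s = Σ[ℓ< L ] (λ ℓ → suc (n / suc ℓ))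
  n≤ : n ≤ ℓ * suc (n / ℓ)
  n≤ = begin
    n                     ≡⟨ m≡m%n+[m/n]*n n ℓ ⟩
    n % ℓ + n / ℓ * ℓ     ≤⟨ +-monoˡ-≤ _ (<⇒≤ (m%n<n n ℓ)) ⟩
    ℓ + n / ℓ * ℓ         ≡⟨ *-comm (suc (n / ℓ)) ℓ ⟩
    ℓ * suc (n / ℓ)       ∎
  bound : n * y + m ≤ c * (s + suc (n / ℓ))
  bound = begin
    n * y + m                     ≤⟨ +-mono-≤ (*-monoˡ-≤ y n≤) m≤ ⟩
    ℓ * suc (n / ℓ) * y + c * s   ≡⟨ rearrange ℓ (suc (n / ℓ)) y (c * s) ⟩
    y * ℓ * suc (n / ℓ) + c * s   ≡⟨ cong (λ c′ → c′ * suc (n / ℓ) + c * s) c≡y*ℓ ⟨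
    c * suc (n / ℓ) + c * s       ≡⟨ collect c s (suc (n / ℓ)) ⟩
    c * (s + suc (n / ℓ))         ∎
    where
    rearrange : ∀ ℓ q y z → ℓ * q * y + z ≡ y * ℓ * q + z
    rearrange = solve-∀
    collect : ∀ c s q → c * q + c * s ≡ c * (s + q)
    collect = solve-∀
  -- The telescoping without fractions: (c + y) ℓ = c (ℓ + 1).
  factor : ∀ c x ℓ y → c ≡ y * ℓ → (c + y) * (x * ℓ) ≡ c * x * suc ℓ
  factor c x ℓ y refl = rearrange x ℓ y
    where
    rearrange : ∀ x ℓ y → (y * ℓ + y) * (x * ℓ) ≡ y * ℓ * x * suc ℓ
    rearrange = solve-∀
  reach : PartialExp≥ c (n * y + m) (n + L * n) ((c ^ suc L * suc ℓ) ^ n)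
  reach = subst (PartialExp≥ c (n * y + m) (n + L * n))
    (trans (sym (^-distribʳ-* (c + y) _ n)) (cong (_^ n) (factor c (c ^ L) ℓ y c≡y*ℓ)))
    (partialExp-steps n y h)

-- exp 3.1 > 20
20≤[21/20]^62 : 20 * 20 ^ 62 ≤ 21 ^ 62
20≤[21/20]^62 = toWitness {a? = 20 * 20 ^ 62 ≤? 21 ^ 62} _

-- Of the n/ℓ full aligned blocks of length ℓ = 1 + k, all but the last have a right neighbour.
blockCount : ℕ → ℕ → ℕ
blockCount n k = n / suc k ∸ 1

-- Each length loses one by rounding up instead of down and one for the last block.
Σ-slack : ∀ n L → Σ[ℓ< L ] (λ ℓ → suc (n / suc ℓ)) ≤ Σ[ℓ< L ] (blockCount n) + 2 * L
Σ-slack n zero    = z≤n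
Σ-slack n (suc L) = begin
  Σ[ℓ< L ] (λ ℓ → suc (n / suc ℓ)) + suc (n / suc L)
    ≤⟨ +-mono-≤ (Σ-slack n L) (s≤s (m≤n+m∸n (n / suc L) 1)) ⟩
  N + 2 * L + (2 + (n / suc L ∸ 1)) ≡⟨ rearrange N L (n / suc L ∸ 1) ⟩
  N + (n / suc L ∸ 1) + 2 * suc L ∎
  where
  open ≤-Reasoning
  N = Σ[ℓ< L ] (blockCount n)
  rearrange : ∀ N L q → N + 2 * L + (2 + q) ≡ N + q + 2 * suc L
  rearrange = solve-∀

-- r is instantiated with 62; as a variable it keeps the type checker from unfolding the powers.
module _ (n σ q L r : ℕ) (r≤62 : r ≤ 62) (20*20^r≤21^r : 20 * 20 ^ r ≤ 21 ^ r)
         (4L≤n : 4 * L ≤ n) (0<n : 0 < n) (σ<20[1+L] : σ < 20 * suc L)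
         (q≥ : Σ[ℓ< L ] (blockCount n) ≤ q) (within : WithinBound n σ q) where

  private
    open ≤-Reasoning

    -- One order of truncation per increment: `r * n` increments of 1/20 and `L * n` of the harmonic
    -- product.
    K : ℕ
    K = r * n + L * n

    -- `D` will be `L !`, so that c = 20 D is a common denominator of 1/20 and of all 1/ℓ with ℓ ≤
    -- L; `t` rescales the denominator 5 of `WithinBound` to `c`.
    module _ (D : ℕ) {{_ : NonZero D}} (t c : ℕ) (t≡4D : t ≡ 4 * D) (c≡5t : c ≡ t * 5) where

      c≡20D : c ≡ 20 * D
      c≡20D = trans c≡5t (trans (cong (_* 5) t≡4D) (rearrange D))
        where
        rearrange : ∀ D → 4 * D * 5 ≡ 20 * D
        rearrange = solve-∀

      instance
        c≢0 : NonZero c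
        c≢0 = subst NonZero (sym c≡20D) (m*n≢0 20 D)

      upper : ∀ {m P} → m ≤ t * (5 * q + 18 * n) → PartialExp≥ c m K P → P ≤ σ ^ n * c ^ K
      upper {m} {P} m≤ (mk h) = *-cancelʳ-≤ P (σ ^ n * c ^ K) (K !) {{K !≢0}} (begin
        P * K !                                  ≤⟨ h ⟩
        expS c m K                               ≤⟨ expS-mono c K m≤ ⟩
        expS c (t * (5 * q + 18 * n)) K          ≡⟨ cong (λ c → expS c (t * (5 * q + 18 * n)) K) c≡5t ⟩
        expS (t * 5) (t * (5 * q + 18 * n)) K    ≡⟨ expS-scale t 5 (5 * q + 18 * n) K ⟩
        t ^ K * expS 5 (5 * q + 18 * n) K        ≡⟨ cong (t ^ K *_) (expScaled≡expS (5 * q + 18 * n) K) ⟨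
        t ^ K * expScaled (5 * q + 18 * n) K     ≤⟨ *-monoʳ-≤ (t ^ K) (within K) ⟩
        t ^ K * (σ ^ n * 5 ^ K * K !)            ≡⟨ rearrange (t ^ K) (σ ^ n) (5 ^ K) (K !) ⟩
        σ ^ n * (t ^ K * 5 ^ K) * K !            ≡⟨ cong (λ z → σ ^ n * z * K !) (^-distribʳ-* t 5 K) ⟨
        σ ^ n * (t * 5) ^ K * K !                ≡⟨ cong (λ c → σ ^ n * c ^ K * K !) c≡5t ⟨
        σ ^ n * c ^ K * K !                      ∎)
        where
        rearrange : ∀ a b d e → a * (b * d * e) ≡ b * (a * d) * e
        rearrange = solve-∀

      -- Divided by c = 20 D: 3.1 n for the factor 20, q for the block pairs and 2 L ≤ n/2 for
      -- rounding make q + 3.6 n.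
      exponent-bound : ∀ {m} → m ≤ c * Σ[ℓ< L ] (λ ℓ → suc (n / suc ℓ)) →
                       r * n * D + m ≤ t * (5 * q + 18 * n)
      exponent-bound {m} m≤ = begin
        r * n * D + m                  ≤⟨ +-mono-≤ (*-monoˡ-≤ D (*-monoˡ-≤ n r≤62)) m≤ ⟩
        62 * n * D + c * Σ[ℓ< L ] (λ ℓ → suc (n / suc ℓ))
          ≤⟨ +-monoʳ-≤ (62 * n * D) (*-monoʳ-≤ c (≤-trans (Σ-slack n L) (+-monoˡ-≤ (2 * L) q≥))) ⟩
        62 * n * D + c * (q + 2 * L)    ≡⟨ cong (λ c → 62 * n * D + c * (q + 2 * L)) c≡20D ⟩
        62 * n * D + 20 * D * (q + 2 * L) ≡⟨ split 62 10 D n q L ⟩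
        62 * n * D + 20 * D * q + 10 * D * (4 * L) ≤⟨ +-monoʳ-≤ (62 * n * D + 20 * D * q) (*-monoʳ-≤ (10 * D) 4L≤n) ⟩
        62 * n * D + 20 * D * q + 10 * D * n ≡⟨ join 62 20 10 D n q ⟩
        20 * D * q + 72 * D * n         ≡⟨ regroup 4 5 18 D q n ⟩
        4 * D * (5 * q + 18 * n)        ≡⟨ cong (_* (5 * q + 18 * n)) t≡4D ⟨
        t * (5 * q + 18 * n)            ∎
        where
        split : ∀ a b D n q L → a * n * D + 2 * b * D * (q + 2 * L)
                            ≡ a * n * D + 2 * b * D * q + b * D * (4 * L)
        split = solve-∀
        join : ∀ a b e D n q → a * n * D + b * D * q + e * D * n ≡ b * D * q + (a + e) * D * n
        join = solve-∀
        regroup : ∀ a b e D q n → a * b * D * q + a * e * D * n ≡ a * D * (b * q + e * n)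
        regroup = solve-∀

      -- The n-th root of the final contradiction. Since (c + D) / c = 21/20, the `r` increments of
      -- 1/20 supply the factor 20 and the harmonic product supplies L + 1.
      base< : σ * c ^ (r + L) < (c + D) ^ r * (c ^ L * suc L)
      base< = begin-strict
        σ * c ^ (r + L)                   <⟨ *-monoˡ-< (c ^ (r + L)) {{m^n≢0 c (r + L)}} σ<20[1+L] ⟩
        20 * suc L * c ^ (r + L)          ≡⟨ cong (20 * suc L *_) (^-distribˡ-+-* c r L) ⟩
        20 * suc L * (c ^ r * c ^ L)      ≡⟨ cong (λ z → 20 * suc L * (z * c ^ L)) c^r ⟩
        20 * suc L * (20 ^ r * D ^ r * c ^ L) ≡⟨ rearrange 20 (suc L) (20 ^ r) (D ^ r) (c ^ L) ⟩
        20 * 20 ^ r * D ^ r * (c ^ L * suc L)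
          ≤⟨ *-monoˡ-≤ (c ^ L * suc L) (*-monoˡ-≤ (D ^ r) 20*20^r≤21^r) ⟩
        21 ^ r * D ^ r * (c ^ L * suc L) ≡⟨ cong (_* (c ^ L * suc L)) (^-distribʳ-* 21 D r) ⟨
        (21 * D) ^ r * (c ^ L * suc L)    ≡⟨ cong (λ z → z ^ r * (c ^ L * suc L)) 21D ⟩
        (c + D) ^ r * (c ^ L * suc L)     ∎
        where
        c^r : c ^ r ≡ 20 ^ r * D ^ r
        c^r = trans (cong (_^ r) c≡20D) (^-distribʳ-* 20 D r)
        rearrange : ∀ a l b d e → a * l * (b * d * e) ≡ a * b * d * (e * l)
        rearrange = solve-∀
        21D : 21 * D ≡ c + D
        21D = trans (+-comm D (20 * D)) (cong (_+ D) (sym c≡20D))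

      contradictory : (∀ ℓ → ℓ < L → suc ℓ ∣ c) → ⊥
      contradictory div with m , m≤ , h ← partialExp-harmonic n c L div =
        <⇒≱ (^-monoˡ-< n {{>-nonZero 0<n}} base<) (begin
          ((c + D) ^ r * (c ^ L * suc L)) ^ n          ≡⟨ ^-distribʳ-* ((c + D) ^ r) _ n ⟩
          ((c + D) ^ r) ^ n * (c ^ L * suc L) ^ n      ≡⟨ cong (_* (c ^ L * suc L) ^ n) (^-*-assoc (c + D) r n) ⟩
          (c + D) ^ (r * n) * (c ^ L * suc L) ^ n
            ≤⟨ upper (exponent-bound m≤) (partialExp-steps (r * n) D h) ⟩
          σ ^ n * c ^ K                                 ≡⟨ cong (λ k → σ ^ n * c ^ k) (*-distribʳ-+ n r L) ⟨
          σ ^ n * c ^ ((r + L) * n)                    ≡⟨ cong (σ ^ n *_) (^-*-assoc c (r + L) n) ⟨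
          σ ^ n * (c ^ (r + L)) ^ n                    ≡⟨ ^-distribʳ-* σ (c ^ (r + L)) n ⟨
          (σ * c ^ (r + L)) ^ n                        ∎)

  exceeds-bound : ⊥
  exceeds-bound = contradictory (L !) {{L !≢0}} _ _ refl refl suc∣c
    where
    suc∣c : ∀ ℓ → ℓ < L → suc ℓ ∣ 4 * L ! * 5
    suc∣c ℓ ℓ<L = ∣m⇒∣m*n 5 (∣n⇒∣m*n 4 (∣-trans (divides (ℓ !) (*-comm (suc ℓ) (ℓ !))) (m≤n⇒m!∣n! ℓ<L)))

-- A square-free word over four letters

odd? : ℕ → Bool
odd? zero    = false
odd? (suc n) = not (odd? n)

-- The parity of the binary digit sum, one digit per call. The fuel makes the recursion structural,
-- and `i` itself suffices because halving decreases a positive number.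
thueMorseFuel : ℕ → ℕ → Bool
thueMorseFuel zero    i = false
thueMorseFuel (suc f) i = odd? i xor thueMorseFuel f ⌊ i /2⌋

thueMorse : ℕ → Bool
thueMorse i = thueMorseFuel i i

thueMorseFuel-zero : ∀ f → thueMorseFuel f 0 ≡ false
thueMorseFuel-zero zero    = refl
thueMorseFuel-zero (suc f) = thueMorseFuel-zero f

thueMorseFuel-irrelevant : ∀ {f g i} → i ≤ f → i ≤ g → thueMorseFuel f i ≡ thueMorseFuel g i
thueMorseFuel-irrelevant {f} {g} {zero} _ _ =
  trans (thueMorseFuel-zero f) (sym (thueMorseFuel-zero g))
thueMorseFuel-irrelevant {suc f} {suc g} {suc i} (s≤s i≤f) (s≤s i≤g) =
  cong (odd? (suc i) xor_) (thueMorseFuel-irrelevant (≤-trans half≤ i≤f) (≤-trans half≤ i≤g))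
  where
  half≤ : ⌊ suc i /2⌋ ≤ i
  half≤ = s≤s⁻¹ (⌊n/2⌋<n i)

odd?-double : ∀ i → odd? (i + i) ≡ false
odd?-double zero = refl
odd?-double (suc i) rewrite +-suc i i | odd?-double i = refl

thueMorse-half : ∀ i → thueMorse i ≡ odd? i xor thueMorse ⌊ i /2⌋
thueMorse-half zero    = refl
thueMorse-half (suc i) = cong (odd? (suc i) xor_)
  (thueMorseFuel-irrelevant (s≤s⁻¹ (⌊n/2⌋<n i)) ≤-refl)

thueMorse-even : ∀ i → thueMorse (i + i) ≡ thueMorse i
thueMorse-even i rewrite thueMorse-half (i + i) | odd?-double i | sym (n≡⌊n+n/2⌋ i) = refl

thueMorse-odd : ∀ i → thueMorse (suc (i + i)) ≡ not (thueMorse i)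
thueMorse-odd i rewrite thueMorse-half (suc (i + i)) | odd?-double i | sym (n≡⌈n+n/2⌉ i) = refl

data ParityView : ℕ → Set where
  even : ∀ i → ParityView (i + i)
  odd  : ∀ i → ParityView (suc (i + i))

parityView : ∀ n → ParityView n
parityView zero    = even 0
parityView (suc n) with parityView n
... | even i = odd i
... | odd  i = subst ParityView (cong suc (+-suc i i)) (even (suc i))

Step : ℕ → Set
Step i = thueMorse i ≢ thueMorse (suc i)

step-even : ∀ i → Step (i + i)
step-even i eq = not-¬ refl (trans (sym (thueMorse-even i)) (trans eq (thueMorse-odd i)))

step-odd⇒¬step : ∀ i → Step (suc (i + i)) → ¬ Step i
step-odd⇒¬step i odd-step step = odd-step (begin
  thueMorse (suc (i + i))       ≡⟨ thueMorse-odd i ⟩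
  not (thueMorse i)             ≡⟨ cong not (¬-not step) ⟩
  not (not (thueMorse (suc i))) ≡⟨ not-involutive (thueMorse (suc i)) ⟩
  thueMorse (suc i)             ≡⟨ thueMorse-even (suc i) ⟨
  thueMorse (suc i + suc i)     ≡⟨ cong (thueMorse ∘ suc) (+-suc i i) ⟩
  thueMorse (suc (suc (i + i))) ∎)
  where
  open ≡-Reasoning

-- Steps at 2i + 1 and 2i + 3 exclude steps at i and at i + 1, but one of these is even.
¬steps-at-odd : ∀ i → Step (suc (i + i)) → Step (suc (suc i + suc i)) → ⊥
¬steps-at-odd i step₁ step₂ with parityView i
... | even a = step-odd⇒¬step (a + a) step₁ (step-even a)
... | odd  a = step-odd⇒¬step (suc (suc (a + a))) step₂ (subst Step (cong suc (+-suc a a)) (step-even (suc a)))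

-- Four consecutive positions contain two consecutive odd ones.
¬four-steps : ∀ s → ¬ (∀ k → k < 4 → Step (k + s))
¬four-steps s steps with parityView s
... | even a = ¬steps-at-odd a (steps 1 (s≤s (s≤s z≤n)))
                 (subst Step (cong (2 +_) (sym (+-suc a a))) (steps 3 ≤-refl))
... | odd  a = ¬steps-at-odd a (steps 0 (s≤s z≤n))
                 (subst Step (cong (2 +_) (sym (+-suc a a))) (steps 2 (s≤s (s≤s (s≤s z≤n)))))

-- A square of period `p` followed by its own first letter; hence k ≤ p and not k < p.
Overlap : ℕ → ℕ → Set
Overlap s p = ∀ k → k ≤ p → thueMorse (k + s) ≡ thueMorse (k + s + p)

-- Every second letter from `s` on spells the word itself or its complement at half the index, with
-- half the period.
overlap-halve : ∀ s q → Overlap s (q + q) → ∃ λ s′ → Overlap s′ q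
overlap-halve s q ov with parityView s
... | even a = a , λ k k≤q → begin
    thueMorse (k + a)                   ≡⟨ thueMorse-even (k + a) ⟨
    thueMorse (k + a + (k + a))         ≡⟨ cong thueMorse (rearrange k a) ⟩
    thueMorse (k + k + (a + a))         ≡⟨ ov (k + k) (+-mono-≤ k≤q k≤q) ⟩
    thueMorse (k + k + (a + a) + (q + q)) ≡⟨ cong thueMorse (rearrange′ k a q) ⟩
    thueMorse (k + a + q + (k + a + q)) ≡⟨ thueMorse-even (k + a + q) ⟩
    thueMorse (k + a + q)               ∎
  where
  open ≡-Reasoning
  rearrange : ∀ k a → k + a + (k + a) ≡ k + k + (a + a)
  rearrange = solve-∀
  rearrange′ : ∀ k a q → k + k + (a + a) + (q + q) ≡ k + a + q + (k + a + q)
  rearrange′ = solve-∀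
... | odd  a = a , λ k k≤q → not-injective (begin
    not (thueMorse (k + a))                   ≡⟨ thueMorse-odd (k + a) ⟨
    thueMorse (suc (k + a + (k + a)))         ≡⟨ cong thueMorse (rearrange k a) ⟩
    thueMorse (k + k + suc (a + a))           ≡⟨ ov (k + k) (+-mono-≤ k≤q k≤q) ⟩
    thueMorse (k + k + suc (a + a) + (q + q)) ≡⟨ cong thueMorse (rearrange′ k a q) ⟩
    thueMorse (suc (k + a + q + (k + a + q))) ≡⟨ thueMorse-odd (k + a + q) ⟩
    not (thueMorse (k + a + q))               ∎)
  where
  open ≡-Reasoning
  rearrange : ∀ k a → suc (k + a + (k + a)) ≡ k + k + suc (a + a)
  rearrange = solve-∀
  rearrange′ : ∀ k a q → k + k + suc (a + a) + (q + q) ≡ suc (k + a + q + (k + a + q))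
  rearrange′ = solve-∀

-- For odd p one of i and i + p is even, and every even position is a step.
step-either : ∀ i q → Step i ⊎ Step (i + suc (q + q))
step-either i q with parityView i
... | even a = inj₁ (step-even a)
... | odd  a = inj₂ (subst Step (rearrange a q) (step-even (suc (a + q))))
  where
  rearrange : ∀ a q → suc (a + q) + suc (a + q) ≡ suc (a + a) + suc (q + q)
  rearrange = solve-∀

-- The overlap carries steps between i and i + p, and one of these two positions is even. The last k
-- consumes the extra letter of the overlap.
overlap-odd⇒steps : ∀ s q → Overlap s (suc (q + q)) → let p = suc (q + q) in
  ∀ k → k < p → Step (k + s) × Step (k + s + p)
overlap-odd⇒steps s q ov k k<p =
  [ (λ st → st , st ∘ back) , (λ st → st ∘ forth , st) ]′ (step-either (k + s) q)
  where
  p = suc (q + q)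
  back : thueMorse (k + s + p) ≡ thueMorse (suc (k + s + p)) → thueMorse (k + s) ≡ thueMorse (suc (k + s))
  back eq = trans (ov k (<⇒≤ k<p)) (trans eq (sym (ov (suc k) k<p)))
  forth : thueMorse (k + s) ≡ thueMorse (suc (k + s)) → thueMorse (k + s + p) ≡ thueMorse (suc (k + s + p))
  forth eq = trans (sym (ov k (<⇒≤ k<p))) (trans eq (ov (suc k) k<p))

-- For p = 1 the step at `s` contradicts the overlap at once; for p ≥ 3 the two copies give at least
-- four steps in a row.
¬overlap-odd : ∀ s q → ¬ Overlap s (suc (q + q))
¬overlap-odd s zero    ov =
  proj₁ (overlap-odd⇒steps s 0 ov 0 ≤-refl) (trans (ov 0 z≤n) (cong thueMorse (+-comm s 1)))
¬overlap-odd s (suc q) ov = ¬four-steps s steps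
  where
  p = suc (suc q + suc q)
  steps : ∀ k → k < 4 → Step (k + s)
  steps k k<4 with k <? p
  ... | yes k<p = proj₁ (overlap-odd⇒steps s (suc q) ov k k<p)
  -- Here k = p = 3: the fourth step is the first one of the second copy.
  ... | no  k≮p = subst Step (begin
          (k ∸ p) + s + p  ≡⟨ rearrange (k ∸ p) s p ⟩
          (k ∸ p) + p + s  ≡⟨ cong (_+ s) (m∸n+n≡m (≮⇒≥ k≮p)) ⟩
          k + s            ∎)
        (proj₂ (overlap-odd⇒steps s (suc q) ov (k ∸ p)
          (≤-<-trans (≤-reflexive (m≤n⇒m∸n≡0 (≤-trans (s≤s⁻¹ k<4) p≥3))) (s≤s z≤n))))
    where
    open ≡-Reasoning
    rearrange : ∀ a s p → a + s + p ≡ a + p + s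
    rearrange = solve-∀
    p≥3 : 3 ≤ suc (suc q + suc q)
    p≥3 = s≤s (s≤s (≤-trans (s≤s z≤n) (m≤n+m (suc q) q)))

-- Descent on the period: even periods are halved, odd ones are impossible.
¬overlap : ∀ p → 0 < p → ∀ s → ¬ Overlap s p
¬overlap = <-rec _ λ p rec 0<p s ov → go p rec 0<p s ov
  where
  go : ∀ p → (∀ {q} → q < p → 0 < q → ∀ s → ¬ Overlap s q) → 0 < p → ∀ s → ¬ Overlap s p
  go p rec 0<p s ov with parityView p
  ... | odd  q = ¬overlap-odd s q ov
  ... | even (suc q) with s′ , ov′ ← overlap-halve s (suc q) ov =
    rec (m<m+n (suc q) (s≤s z≤n)) (s≤s z≤n) s′ ov′

bit : Bool → ℕ
bit false = 0
bit true  = 1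

-- Codes two adjacent Thue-Morse letters, so that a square of codes reveals the one extra letter
-- that makes an overlap.
letter : ℕ → ℕ
letter i = bit (thueMorse i) + 2 * bit (thueMorse (suc i))

letter<4 : ∀ i → letter i < 4
letter<4 i with thueMorse i | thueMorse (suc i)
... | false | false = s≤s z≤n
... | false | true  = s≤s (s≤s (s≤s z≤n))
... | true  | false = s≤s (s≤s z≤n)
... | true  | true  = ≤-refl

letter-injective : ∀ i j → letter i ≡ letter j →
  thueMorse i ≡ thueMorse j × thueMorse (suc i) ≡ thueMorse (suc j)
letter-injective i j eq
  with thueMorse i | thueMorse (suc i) | thueMorse j | thueMorse (suc j)
... | false | false | false | false = refl , refl
... | false | true  | false | true  = refl , refl
... | true  | false | true  | false = refl , refl
... | true  | true  | true  | true  = refl , refl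
letter-injective i j () | false | false | false | true
letter-injective i j () | false | false | true | false
letter-injective i j () | false | false | true | true
letter-injective i j () | false | true | false | false
letter-injective i j () | false | true | true | false
letter-injective i j () | false | true | true | true
letter-injective i j () | true | false | false | false
letter-injective i j () | true | false | false | true
letter-injective i j () | true | false | true | true
letter-injective i j () | true | true | false | false
letter-injective i j () | true | true | false | true
letter-injective i j () | true | true | true | false

-- A square of period p in the word of letters is an overlap of period p in the Thue–Morse word.
letter-squareFree : ∀ s p → 0 < p → ¬ (∀ k → k < p → letter (k + s) ≡ letter (k + s + p))
letter-squareFree s (suc p) 0<p sq = ¬overlap (suc p) 0<p s ov
  where
  ov : Overlap s (suc p)
  ov k k≤p with m≤n⇒m<n∨m≡n k≤p
  ... | inj₁ k<p  = proj₁ (letter-injective (k + s) (k + s + suc p) (sq k k<p))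
  ... | inj₂ refl = proj₂ (letter-injective (p + s) (p + s + suc p) (sq p ≤-refl))

-- Squares in lists as periods of functions

applyUpTo-cong : ∀ {A : Set} {f g : ℕ → A} n → (∀ k → k < n → f k ≡ g k) → applyUpTo f n ≡ applyUpTo g n
applyUpTo-cong zero    f≗g = refl
applyUpTo-cong (suc n) f≗g = cong₂ _∷_ (f≗g 0 (s≤s z≤n)) (applyUpTo-cong n λ k k<n → f≗g (suc k) (s≤s k<n))

applyUpTo-++ˡ : ∀ {A : Set} (f : ℕ → A) n (v r : List A) → applyUpTo f n ≡ v ++ r →
  v ≡ applyUpTo f (length v) × ∃ λ m → r ≡ applyUpTo (λ k → f (k + length v)) m
applyUpTo-++ˡ f n []      r eq = refl , n , trans (sym eq) (applyUpTo-cong n λ k _ → cong f (sym (+-identityʳ k)))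
applyUpTo-++ˡ f (suc n) (x ∷ v) r eq
  with refl , eq′ ← ∷-injective eq
  with v≡ , m , r≡ ← applyUpTo-++ˡ (f ∘ suc) n v r eq′
  = cong (f 0 ∷_) v≡ , m , trans r≡ (applyUpTo-cong m λ k _ → cong f (sym (+-suc k (length v))))

applyUpTo-injective : ∀ {A : Set} (f g : ℕ → A) n → applyUpTo f n ≡ applyUpTo g n → ∀ k → k < n → f k ≡ g k
applyUpTo-injective f g (suc n) eq zero    _         = proj₁ (∷-injective eq)
applyUpTo-injective f g (suc n) eq (suc k) (s≤s k<n) = applyUpTo-injective (f ∘ suc) (g ∘ suc) n (proj₂ (∷-injective eq)) k k<n

hasSquare⇒periodic : ∀ {A : Set} (f : ℕ → A) n → HasSquare (applyUpTo f n) →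
  ∃ λ s → ∃ λ p → 0 < p × (∀ k → k < p → f (k + s) ≡ f (k + s + p))
hasSquare⇒periodic f n (u , [] , w , v≢[] , eq) = contradiction refl v≢[]
hasSquare⇒periodic f n (u , v@(_ ∷ _) , w , v≢[] , eq)
  with _ , m₁ , eq₁ ← applyUpTo-++ˡ f n u (v ++ v ++ w) eq
  with v≡₁ , m₂ , eq₂ ← applyUpTo-++ˡ _ m₁ v (v ++ w) (sym eq₁)
  with v≡₂ , _ ← applyUpTo-++ˡ _ m₂ v w (sym eq₂)
  = s , p , s≤s z≤n , λ k k<p →
    trans (applyUpTo-injective (λ k → f (k + s)) (λ k → f (k + p + s)) p (trans (sym v≡₁) v≡₂) k k<p) (cong f (rearrange k p s))
  where
  s = length u
  p = length v
  rearrange : ∀ k p s → k + p + s ≡ k + s + p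
  rearrange = solve-∀

applyUpTo-+ : ∀ {A : Set} (f : ℕ → A) a b → applyUpTo f (a + b) ≡ applyUpTo f a ++ applyUpTo (λ k → f (a + k)) b
applyUpTo-+ f zero    b = refl
applyUpTo-+ f (suc a) b = cong (f 0 ∷_) (applyUpTo-+ (f ∘ suc) a b)

periodic⇒hasSquare : ∀ {A : Set} (f : ℕ → A) {n} s p → 0 < p → s + p + p ≤ n →
  (∀ k → k < p → f (s + k) ≡ f (s + k + p)) → HasSquare (applyUpTo f n)
periodic⇒hasSquare f {n} s p@(suc _) 0<p s+2p≤n periodic =
  applyUpTo f s , v , applyUpTo (λ k → f (s + (p + (p + k)))) r , (λ ()) , (begin
    applyUpTo f n                 ≡⟨ cong (applyUpTo f) (m+[n∸m]≡n s+2p≤n) ⟨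
    applyUpTo f (s + p + p + r)   ≡⟨ cong (applyUpTo f) (trans (+-assoc (s + p) p r) (+-assoc s p (p + r))) ⟩
    applyUpTo f (s + (p + (p + r))) ≡⟨ applyUpTo-+ f s _ ⟩
    applyUpTo f s ++ applyUpTo (λ k → f (s + k)) (p + (p + r)) ≡⟨ cong (applyUpTo f s ++_) (applyUpTo-+ (λ k → f (s + k)) p _) ⟩
    applyUpTo f s ++ v ++ applyUpTo (λ k → f (s + (p + k))) (p + r)
      ≡⟨ cong (λ z → applyUpTo f s ++ v ++ z) (applyUpTo-+ (λ k → f (s + (p + k))) p r) ⟩
    applyUpTo f s ++ v ++ applyUpTo (λ k → f (s + (p + k))) p ++ applyUpTo (λ k → f (s + (p + (p + k)))) r
      ≡⟨ cong (λ z → applyUpTo f s ++ v ++ z ++ applyUpTo (λ k → f (s + (p + (p + k)))) r)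
           (applyUpTo-cong p λ k k<p → trans (cong f (rearrange s p k)) (sym (periodic k k<p))) ⟩
    applyUpTo f s ++ v ++ v ++ applyUpTo (λ k → f (s + (p + (p + k)))) r ∎)
  where
  open ≡-Reasoning
  v = applyUpTo (λ k → f (s + k)) p
  r = n ∸ (s + p + p)
  rearrange : ∀ s p k → s + (p + k) ≡ s + k + p
  rearrange = solve-∀

-- The adversary

module _ {A : Set} {P Q R : A → Set} (P? : Decidable P) (Q? : Decidable Q) (R? : Decidable R) where

  length-filter-∪ : (∀ x → P x → Q x ⊎ R x) → ∀ xs →
    length (filter P? xs) ≤ length (filter Q? xs) + length (filter R? xs)
  length-filter-∪ P⊆Q∪R []       = z≤n
  length-filter-∪ P⊆Q∪R (x ∷ xs) with ih ← length-filter-∪ P⊆Q∪R xs | P? x | Q? x | R? x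
  ... | no  _  | no  _  | no  _  = ih
  ... | no  _  | no  _  | yes _  = ≤-trans (m≤n⇒m≤1+n ih) (≤-reflexive (sym (+-suc _ _)))
  ... | no  _  | yes _  | no  _  = m≤n⇒m≤1+n ih
  ... | no  _  | yes _  | yes _  = m≤n⇒m≤1+n (≤-trans ih (+-monoʳ-≤ _ (n≤1+n _)))
  ... | yes _  | no  _  | yes _  = ≤-trans (s≤s ih) (≤-reflexive (sym (+-suc _ _)))
  ... | yes _  | yes _  | no  _  = s≤s ih
  ... | yes _  | yes _  | yes _  = s≤s (≤-trans ih (+-monoʳ-≤ _ (n≤1+n _)))
  ... | yes px | no ¬qx | no ¬rx = ⊥-elim ([ ¬qx , ¬rx ]′ (P⊆Q∪R x px))

length-filter-mono : ∀ {A : Set} {P Q : A → Set} (P? : Decidable P) (Q? : Decidable Q) →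
  (∀ x → P x → Q x) → ∀ xs → length (filter P? xs) ≤ length (filter Q? xs)
length-filter-mono P? Q? P⊆Q []       = z≤n
length-filter-mono P? Q? P⊆Q (x ∷ xs) with ih ← length-filter-mono P? Q? P⊆Q xs | P? x | Q? x
... | no  _  | no  _  = ih
... | no  _  | yes _  = m≤n⇒m≤1+n ih
... | yes _  | yes _  = s≤s ih
... | yes px | no ¬qx = contradiction (P⊆Q x px) ¬qx

length-filter-∷ : ∀ {A : Set} {P : A → Set} (P? : Decidable P) x xs →
  length (filter P? xs) ≤ length (filter P? (x ∷ xs))
length-filter-∷ P? x xs with P? x
... | yes _ = n≤1+n _
... | no  _ = ≤-refl

-- Pigeonhole: otherwise the positions in `F` of the `m` values would be an injection into fewer
-- places.
fresh : ∀ {C : Set} (_≟_ : DecidableEquality C) {m} (e : Fin m → C) → Injective _≡_ _≡_ e →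
  (F : List C) → length F < m → ∃ λ j → e j ∉ F
fresh _≟_ e e-inj F F<m with any? (λ j → ¬? (_∈?_ _≟_ (e j) F))
... | yes fr = fr
... | no ¬fr = contradiction (injective⇒≤ index-inj) (<⇒≱ F<m)
  where
  e∈F : ∀ j → e j ∈ F
  e∈F j = decidable-stable (_∈?_ _≟_ (e j) F) (λ ∉F → ¬fr (j , ∉F))
  index-inj : Injective _≡_ _≡_ (λ j → index (e∈F j))
  index-inj {i} {j} eq = e-inj (trans (lookup-index (e∈F i))
    (trans (cong (lookup F) eq) (sym (lookup-index (e∈F j)))))

module Adversary (σ : ℕ) where

  -- inj₂ x is the private colour of a position x that is not yet committed to a symbol.
  Colour : Set
  Colour = Fin σ ⊎ ℕ

  _≟ᶜ_ : DecidableEquality Colour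
  _≟ᶜ_ = ⊎-≡-dec _≟ᶠ_ _≟_

  -- A colour inj₂ v may also be shared by several positions, which must then receive the same
  -- symbol; this is how two blocks are made equal.
  Colouring : Set
  Colouring = ℕ → Colour

  -- The pairs answered "different", in both orientations, so that an entry is half a comparison.
  Edges : Set
  Edges = List (ℕ × ℕ)

  private variable
    χ χ′ : Colouring
    H : Edges

  inClass? : (χ : Colouring) (v : ℕ) → Decidable (λ (e : ℕ × ℕ) → χ (proj₁ e) ≡ inj₂ v)
  inClass? χ v e = χ (proj₁ e) ≟ᶜ inj₂ v

  classDegree : Colouring → Edges → ℕ → ℕ
  classDegree χ H v = length (filter (inClass? χ v) H)

  from? : (x : ℕ) → Decidable (λ (e : ℕ × ℕ) → proj₁ e ≡ x)
  from? x e = proj₁ e ≟ x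

  degree : Edges → ℕ → ℕ
  degree H x = length (filter (from? x) H)

  Symmetric : Edges → Set
  Symmetric H = ∀ {a b} → (a , b) ∈ H → (b , a) ∈ H

  Proper : Colouring → Edges → Set
  Proper χ H = ∀ {a b} → (a , b) ∈ H → χ a ≢ χ b

  -- Answers "equal" leave no trace here: they are given only to positions of equal colour, where
  -- `same-colour` enforces them.
  Realizes : (ℕ → Fin σ) → Colouring → Edges → Set
  Realizes τ χ H = (∀ x c → χ x ≡ inj₁ c → τ x ≡ c) × (∀ {a b} → (a , b) ∈ H → τ a ≢ τ b)

  paint : ℕ → Fin σ → Colour → Colour
  paint v c (inj₁ x) = inj₁ x
  paint v c (inj₂ u) with u ≟ v
  ... | yes _ = inj₁ c
  ... | no  _ = inj₂ u

  paint-self : ∀ v c → paint v c (inj₂ v) ≡ inj₁ c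
  paint-self v c with v ≟ v
  ... | yes _ = refl
  ... | no v≢v = contradiction refl v≢v

  paint-inj₂ : ∀ v c x {u} → paint v c x ≡ inj₂ u → x ≡ inj₂ u
  paint-inj₂ v c (inj₂ w) eq with w ≟ v
  ... | no _ = eq

  paint-inj₁ : ∀ v c x {c′} → paint v c x ≡ inj₁ c′ → x ≡ inj₁ c′ ⊎ (x ≡ inj₂ v × c ≡ c′)
  paint-inj₁ v c (inj₁ x) eq = inj₁ eq
  paint-inj₁ v c (inj₂ w) eq with w ≟ v
  ... | yes refl = inj₂ (refl , inj₁-injective eq)

  paint-collision : ∀ v c x y → paint v c x ≡ paint v c y →
    x ≡ y ⊎ (x ≡ inj₂ v × y ≡ inj₁ c) ⊎ (y ≡ inj₂ v × x ≡ inj₁ c)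
  paint-collision v c x y eq with paint v c y in eqy
  ... | inj₂ u = inj₁ (trans (paint-inj₂ v c x eq) (sym (paint-inj₂ v c y eqy)))
  ... | inj₁ c′ with paint-inj₁ v c x eq | paint-inj₁ v c y eqy
  ...   | inj₁ x≡           | inj₁ y≡          = inj₁ (trans x≡ (sym y≡))
  ...   | inj₁ x≡           | inj₂ (y≡ , refl) = inj₂ (inj₂ (y≡ , x≡))
  ...   | inj₂ (x≡ , refl)  | inj₁ y≡          = inj₂ (inj₁ (x≡ , y≡))
  ...   | inj₂ (x≡ , _)     | inj₂ (y≡ , _)    = inj₁ (trans x≡ (sym y≡))

  forbidden : Colouring → Edges → ℕ → List Colour
  forbidden χ H v = map (χ ∘ proj₂) (filter (inClass? χ v) H)

  -- Painting identifies only inj₂ v with inj₁ c, so a conflict is an edge between these two; `symm`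
  -- turns it to start in the class, where `forbidden` sees it.
  paint-proper : ∀ {v c} → Proper χ H → Symmetric H → inj₁ c ∉ forbidden χ H v → Proper (paint v c ∘ χ) H
  paint-proper {χ} {H} {v} {c} proper symm c∉ {a} {b} ab∈H eq with paint-collision v c (χ a) (χ b) eq
  ... | inj₁ χa≡χb = proper ab∈H χa≡χb
  ... | inj₂ (inj₁ (χa≡ , χb≡)) = c∉ (subst (_∈ forbidden χ H v) χb≡
          (∈-map⁺ (χ ∘ proj₂) (∈-filter⁺ (inClass? χ v) ab∈H χa≡)))
  ... | inj₂ (inj₂ (χb≡ , χa≡)) = c∉ (subst (_∈ forbidden χ H v) χa≡
          (∈-map⁺ (χ ∘ proj₂) (∈-filter⁺ (inClass? χ v) (symm ab∈H) χb≡)))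

  -- `bound` is a degree: a class must avoid at most one colour per edge leaving it. `Q` is the
  -- group restriction, or trivial when a square is planted.
  Choice : (ℕ → ℕ) → (ℕ → Fin σ → Set) → Set
  Choice bound Q = ∀ v (F : List Colour) → length F ≤ bound v → ∃ λ c → inj₁ c ∉ F × Q v c

  -- Greedy completion of a proper colouring

  module _ {n : ℕ} {χ : Colouring} {H : Edges} (proper : Proper χ H) (symm : Symmetric H)
           (range : ∀ {a b} → (a , b) ∈ H → a < n)
           (classes<n : ∀ x v → x < n → χ x ≡ inj₂ v → v < n)
           {Q : ℕ → Fin σ → Set} (choice : Choice (classDegree χ H) Q) where

    private
      Committed : (ℕ → Colour) → ℕ → Set
      Committed g v = ∃ λ c → g v ≡ inj₁ c × Q v c

      -- Classes are painted in increasing order; `g` gives the current colour of each class and is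
      -- inj₂ v while class v awaits its turn.
      greedy : ∀ m → ∃ λ (g : ℕ → Colour) →
        (∀ v → g v ≡ inj₂ v ⊎ Committed g v) × (∀ v → v < m → Committed g v) ×
        Proper ([ inj₁ , g ]′ ∘ χ) H
      greedy zero = inj₂ , (λ v → inj₁ refl) , (λ v ()) , λ {a} {b} ab∈H eq →
        proper ab∈H (trans (sym (η (χ a))) (trans eq (η (χ b))))
        where
        η : ∀ (x : Colour) → [ inj₁ , inj₂ ]′ x ≡ x
        η (inj₁ _) = refl
        η (inj₂ _) = refl
      greedy (suc m) with g , shape , done , g-proper ← greedy m with shape m
      ... | inj₂ committed = g , shape , done′ , g-proper
        where
        done′ : ∀ v → v < suc m → Committed g v
        done′ v v<1+m with m≤n⇒m<n∨m≡n (s≤s⁻¹ v<1+m)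
        ... | inj₁ v<m  = done v v<m
        ... | inj₂ refl = committed
      ... | inj₁ gm≡ = paint m c ∘ g , shape′ , done′ , proper′
        where
        ψ : Colouring
        ψ = [ inj₁ , g ]′ ∘ χ
        -- Earlier choices never enlarge a class, so its original degree still bounds the number of
        -- forbidden colours.
        class⊆ : ∀ x → ψ x ≡ inj₂ m → χ x ≡ inj₂ m
        class⊆ x eq with χ x
        ... | inj₂ u with shape u
        ...   | inj₁ gu≡ = trans (sym gu≡) eq
        ...   | inj₂ (_ , gu≡ , _) with () ← trans (sym gu≡) eq
        picked = choice m (forbidden ψ H m)
          (≤-trans (≤-reflexive (length-map _ (filter (inClass? ψ m) H)))
                   (length-filter-mono (inClass? ψ m) (inClass? χ m) (class⊆ ∘ proj₁) H))
        c = proj₁ picked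
        shape′ : ∀ v → paint m c (g v) ≡ inj₂ v ⊎ Committed (paint m c ∘ g) v
        shape′ v with shape v
        ... | inj₂ (c′ , gv≡ , qc′) = inj₂ (c′ , cong (paint m c) gv≡ , qc′)
        ... | inj₁ gv≡ rewrite gv≡ with v ≟ m
        ...   | yes refl = inj₂ (c , refl , proj₂ (proj₂ picked))
        ...   | no  _    = inj₁ refl
        done′ : ∀ v → v < suc m → Committed (paint m c ∘ g) v
        done′ v v<1+m with m≤n⇒m<n∨m≡n (s≤s⁻¹ v<1+m)
        ... | inj₁ v<m with c′ , gv≡ , qc′ ← done v v<m = c′ , cong (paint m c) gv≡ , qc′
        ... | inj₂ refl = c , trans (cong (paint m c) gm≡) (paint-self m c) , proj₂ (proj₂ picked)
        proper′ : Proper ([ inj₁ , paint m c ∘ g ]′ ∘ χ) H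
        proper′ {a} {b} ab∈H eq =
          paint-proper {χ = ψ} g-proper symm (proj₁ (proj₂ picked)) ab∈H
            (trans (η (χ a)) (trans eq (sym (η (χ b)))))
          where
          η : ∀ x → paint m c ([ inj₁ , g ]′ x) ≡ [ inj₁ , paint m c ∘ g ]′ x
          η (inj₁ _) = refl
          η (inj₂ _) = refl

    complete : ∃ λ (f : ℕ → Fin σ) → (∀ v → Q v (f v)) × Realizes ([ id , f ]′ ∘ χ) χ H
    complete with g , shape , done , g-proper ← greedy n =
      f , f-Q , kept , λ {a} {b} ab∈H eq →
        g-proper ab∈H (trans (resolved a (range ab∈H))
          (trans (cong inj₁ eq) (sym (resolved b (range (symm ab∈H))))))
      where
      settle : ∀ v → ∃ λ c → (∀ c′ → g v ≡ inj₁ c′ → c ≡ c′) × Q v c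
      settle v with shape v
      ... | inj₂ (c , gv≡ , qc) = c , (λ c′ gv≡′ → inj₁-injective (trans (sym gv≡) gv≡′)) , qc
      -- A class still unpainted after `n` rounds meets no edge; any symbol with `Q` serves as its
      -- default.
      ... | inj₁ gv≡ with c , _ , qc ← choice v [] z≤n =
        c , (λ c′ gv≡′ → case-absurd (trans (sym gv≡) gv≡′)) , qc
        where
        case-absurd : ∀ {A : Set} {v : ℕ} {c : Fin σ} → _≡_ {A = Colour} (inj₂ v) (inj₁ c) → A
        case-absurd ()
      f : ℕ → Fin σ
      f v = proj₁ (settle v)
      f-Q : ∀ v → Q v (f v)
      f-Q v = proj₂ (proj₂ (settle v))
      kept : ∀ x c → χ x ≡ inj₁ c → [ id , f ]′ (χ x) ≡ c
      kept x c eq rewrite eq = refl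
      resolved : ∀ x → x < n → [ inj₁ , g ]′ (χ x) ≡ inj₁ ([ id , f ]′ (χ x))
      resolved x x<n with χ x in eq
      ... | inj₁ c = refl
      ... | inj₂ v with c , gv≡ , _ ← done v (classes<n x v x<n eq) =
        trans gv≡ (cong inj₁ (sym (proj₁ (proj₂ (settle v)) c gv≡)))

  -- The strategy and its invariant

  module Play (n d : ℕ) (group : Fin σ → ℕ) (word : ℕ → ℕ)
              (choice : Choice (λ _ → d) (λ x c → group c ≡ word x)) where

    -- `sparse` keeps the forbidden colours of an uncommitted position within the supply of its
    -- group; `saturated` later pays for the blocks that a committed position spoils.
    record Valid (χ : Colouring) (H : Edges) : Set where
      field
        proper    : Proper χ H
        symm      : Symmetric H
        range     : ∀ {a b} → (a , b) ∈ H → a < n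
        shape     : ∀ x → χ x ≡ inj₂ x ⊎ ∃ λ c → χ x ≡ inj₁ c × group c ≡ word x
        sparse    : ∀ v → classDegree χ H v ≤ d
        saturated : ∀ x {c} → χ x ≡ inj₁ c → d ≤ degree H x

    open Valid

    initial : Valid inj₂ []
    initial = record
      { proper = λ () ; symm = λ () ; range = λ () ; shape = λ x → inj₁ refl
      ; sparse = λ v → z≤n ; saturated = λ x () }

    shape-inj₂ : Valid χ H → ∀ x {v} → χ x ≡ inj₂ v → x ≡ v
    shape-inj₂ V x eq with shape V x
    ... | inj₁ χx≡ = inj₂-injective (trans (sym χx≡) eq)
    ... | inj₂ (_ , χx≡ , _) with () ← trans (sym χx≡) eq

    -- `keep` lets realizations of the later colouring realize the earlier one; `reflect` keeps
    -- class degrees from growing.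
    record _⊑_ (χ χ′ : Colouring) : Set where
      field
        keep   : ∀ x {c} → χ x ≡ inj₁ c → χ′ x ≡ inj₁ c
        reflect : ∀ x {v} → χ′ x ≡ inj₂ v → χ x ≡ inj₂ v

    open _⊑_

    Ready : Colouring → Edges → ℕ → Set
    Ready χ H i = ∀ v → χ i ≡ inj₂ v → classDegree χ H v < d

    Ready-⊑ : χ ⊑ χ′ → ∀ i → Ready χ H i → Ready χ′ H i
    Ready-⊑ {χ} {χ′} {H} χ⊑χ′ i ready v eq = ≤-<-trans
      (length-filter-mono (inClass? χ′ v) (inClass? χ v) (λ e → reflect χ⊑χ′ (proj₁ e)) H)
      (ready v (reflect χ⊑χ′ i eq))

    Realizes-⊑ : χ ⊑ χ′ → ∀ {τ} → Realizes τ χ′ H → Realizes τ χ H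
    Realizes-⊑ χ⊑χ′ (kept , separated) = (λ x c eq → kept x c (keep χ⊑χ′ x eq)) , separated

    -- A position that has used up its `d` unequal answers is committed before the next answer; its
    -- at most `d` forbidden colours leave a symbol of its group.
    settle : Valid χ H → ∀ i → ∃ λ χ′ → χ ⊑ χ′ × Valid χ′ H × Ready χ′ H i
    settle {χ} {H} V i with χ i in χi≡
    ... | inj₁ c = χ , record { keep = λ x eq → eq ; reflect = λ x eq → eq } , V ,
                   λ v eq → contradiction (trans (sym χi≡) eq) λ ()
    ... | inj₂ v with refl ← shape-inj₂ V i χi≡ with classDegree χ H i <? d
    ...   | yes deg<d = χ , record { keep = λ x eq → eq ; reflect = λ x eq → eq } , V ,
                   λ v eq → subst (λ v → classDegree χ H v < d) (inj₂-injective (trans (sym χi≡) eq)) deg<d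
    ...   | no  deg≮d = paint i c ∘ χ , χ⊑ , V′ , λ v eq →
                   contradiction (trans (sym (trans (cong (paint i c) χi≡) (paint-self i c))) eq) λ ()
      where
      picked = choice i (forbidden χ H i)
        (≤-trans (≤-reflexive (length-map _ (filter (inClass? χ i) H))) (sparse V i))
      c = proj₁ picked
      χ⊑ : χ ⊑ (paint i c ∘ χ)
      χ⊑ = record { keep = λ x eq → cong (paint i c) eq ; reflect = λ x → paint-inj₂ i c (χ x) }
      shape′ : ∀ x → paint i c (χ x) ≡ inj₂ x ⊎ ∃ λ c′ → paint i c (χ x) ≡ inj₁ c′ × group c′ ≡ word x
      shape′ x with shape V x
      ... | inj₂ (c′ , χx≡ , g≡) = inj₂ (c′ , cong (paint i c) χx≡ , g≡)
      ... | inj₁ χx≡ rewrite χx≡ with x ≟ i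
      ...   | yes refl = inj₂ (c , refl , proj₂ (proj₂ picked))
      ...   | no  _    = inj₁ refl
      saturated′ : ∀ x {c′} → paint i c (χ x) ≡ inj₁ c′ → d ≤ degree H x
      saturated′ x eq with paint-inj₁ i c (χ x) eq
      ... | inj₁ χx≡ = saturated V x χx≡
      ... | inj₂ (χx≡ , _) with refl ← shape-inj₂ V x χx≡ =
        ≤-trans (≮⇒≥ deg≮d)
          (length-filter-mono (inClass? χ x) (from? x) (λ e → shape-inj₂ V (proj₁ e)) H)
      V′ : Valid (paint i c ∘ χ) H
      V′ = record
        { proper = paint-proper {χ = χ} (proper V) (symm V) (proj₁ (proj₂ picked))
        ; symm = symm V
        ; range = range V
        ; shape = shape′
        ; sparse = λ v → ≤-trans (length-filter-mono (inClass? (paint i c ∘ χ) v) (inClass? χ v)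
                                   (λ e → reflect χ⊑ (proj₁ e)) H) (sparse V v)
        ; saturated = saturated′
        }

    -- Since the colours differ, a class holds at most one of the endpoints and gains at most one
    -- entry, for which readiness leaves room.
    addEdge : Valid χ H → ∀ {i j} → i < n → j < n → Ready χ H i → Ready χ H j → χ i ≢ χ j →
              Valid χ ((i , j) ∷ (j , i) ∷ H)
    addEdge {χ} {H} V {i} {j} i<n j<n ready-i ready-j χi≢χj = record
      { proper = λ { (here refl) → χi≢χj ; (there (here refl)) → χi≢χj ∘ sym ; (there (there e∈)) → proper V e∈ }
      ; symm = λ { (here refl) → there (here refl) ; (there (here refl)) → here refl
                 ; (there (there e∈)) → there (there (symm V e∈)) }
      ; range = λ { (here refl) → i<n ; (there (here refl)) → j<n ; (there (there e∈)) → range V e∈ }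
      ; shape = shape V
      ; sparse = sparse′
      ; saturated = λ x eq → ≤-trans (saturated V x eq)
          (≤-trans (length-filter-∷ (from? x) (j , i) H) (length-filter-∷ (from? x) (i , j) ((j , i) ∷ H)))
      }
      where
      sparse′ : ∀ v → classDegree χ ((i , j) ∷ (j , i) ∷ H) v ≤ d
      sparse′ v with χ i ≟ᶜ inj₂ v
      ... | yes χi≡ with χ j ≟ᶜ inj₂ v
      ...   | yes χj≡ = contradiction (trans χi≡ (sym χj≡)) χi≢χj
      ...   | no  _   = ready-i v χi≡
      sparse′ v | no _ with χ j ≟ᶜ inj₂ v
      ...   | yes χj≡ = ready-j v χj≡
      ...   | no  _   = sparse V v

    -- By `shape`, equal colours mean the same committed symbol or the same position.
    same-colour : Valid χ H → ∀ {τ i j} → Realizes τ χ H → χ i ≡ χ j → τ i ≡ τ j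
    same-colour {χ} V {τ} {i} {j} (kept , _) χi≡χj with shape V i
    ... | inj₂ (c , χi≡ , _) = trans (kept i c χi≡) (sym (kept j c (trans (sym χi≡χj) χi≡)))
    ... | inj₁ χi≡ = cong τ (sym (shape-inj₂ V j (trans (sym χi≡χj) χi≡)))

    string : (ℕ → Fin σ) → Vec (Fin σ) n
    string τ = tabulate (τ ∘ toℕ)

    run-≡ : ∀ τ i j t f → τ (toℕ i) ≡ τ (toℕ j) → run (ask i j t f) (string τ) ≡ run t (string τ)
    run-≡ τ i j t f eq with lookupᵛ (string τ) i ≟ᶠ lookupᵛ (string τ) j
    ... | yes _ = refl
    ... | no ¬eq = contradiction
      (trans (lookup∘tabulate _ i) (trans eq (sym (lookup∘tabulate _ j)))) ¬eq

    run-≢ : ∀ τ i j t f → τ (toℕ i) ≢ τ (toℕ j) → run (ask i j t f) (string τ) ≡ run f (string τ)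
    run-≢ τ i j t f neq with lookupᵛ (string τ) i ≟ᶠ lookupᵛ (string τ) j
    ... | no _ = refl
    ... | yes eq = contradiction
      (trans (sym (lookup∘tabulate _ i)) (trans eq (lookup∘tabulate _ j))) neq

    -- Both positions are settled first; the answer is "equal" exactly if their colours then agree.
    -- Each unequal answer adds two entries, and all realizations of the final state follow the same
    -- path.
    adversary : (D : DecTree n) → Valid χ H → ∃ λ χ′ → ∃ λ H′ → ∃ λ b →
      Valid χ′ H′ × length H′ ≤ 2 * depth D + length H ×
      (∀ τ → Realizes τ χ′ H′ → Realizes τ χ H × run D (string τ) ≡ b)
    adversary {χ} {H} (leaf b) V = χ , H , b , V , ≤-refl , λ τ R → R , refl
    adversary {χ} {H} (ask i j t f) V
      with χ₁ , χ⊑χ₁ , V₁ , ready-i ← settle V (toℕ i)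
      with χ₂ , χ₁⊑χ₂ , V₂ , ready-j ← settle V₁ (toℕ j)
      with χ₂ (toℕ i) ≟ᶜ χ₂ (toℕ j)
    ... | yes eq with χ′ , H′ , b , V′ , len , ok ← adversary t V₂ =
      χ′ , H′ , b , V′ ,
      ≤-trans len (+-monoˡ-≤ (length H) (*-monoʳ-≤ 2 (m≤n⇒m≤1+n (m≤m⊔n (depth t) (depth f))))) ,
      λ τ R → let R₂ , run≡ = ok τ R in
        Realizes-⊑ χ⊑χ₁ (Realizes-⊑ χ₁⊑χ₂ R₂) , trans (run-≡ τ i j t f (same-colour V₂ R₂ eq)) run≡
    ... | no neq with χ′ , H′ , b , V′ , len , ok ←
          adversary f (addEdge V₂ (toℕ<n i) (toℕ<n j) (Ready-⊑ {H = H} χ₁⊑χ₂ (toℕ i) ready-i) ready-j neq) =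
      χ′ , H′ , b , V′ ,
      ≤-trans len (≤-trans (≤-reflexive (rearrange (depth f) (length H)))
        (+-monoˡ-≤ (length H) (*-monoʳ-≤ 2 (s≤s (m≤n⊔m (depth t) (depth f)))))) ,
      λ τ R → let (kept , separated) , run≡ = ok τ R in
        Realizes-⊑ χ⊑χ₁ (Realizes-⊑ χ₁⊑χ₂ (kept , separated ∘ there ∘ there)) ,
        trans (run-≢ τ i j t f (separated (here refl))) run≡
      where
      rearrange : ∀ q l → 2 * q + (2 + l) ≡ 2 * (1 + q) + l
      rearrange = solve-∀

-- Counting block pairs

toList-tabulate : ∀ {A : Set} (f : ℕ → A) n → toList (tabulate {n = n} (f ∘ toℕ)) ≡ applyUpTo f n
toList-tabulate f zero    = refl
toList-tabulate f (suc n) = cong (f 0 ∷_) (toList-tabulate (f ∘ suc) n)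

lookup-injective : ∀ {A : Set} {xs : List A} → Unique xs → ∀ i j → lookup xs i ≡ lookup xs j → i ≡ j
lookup-injective (_  ∷ u) Fin.zero    Fin.zero    eq = refl
lookup-injective (x∉ ∷ u) Fin.zero    (Fin.suc j) eq = contradiction eq (All.lookup x∉ (∈-lookup j))
lookup-injective (x∉ ∷ u) (Fin.suc i) Fin.zero    eq = contradiction (sym eq) (All.lookup x∉ (∈-lookup i))
lookup-injective (_  ∷ u) (Fin.suc i) (Fin.suc j) eq = cong Fin.suc (lookup-injective u i j eq)

unique-⊆⇒length≤ : ∀ {A : Set} {xs ys : List A} → Unique xs → (∀ {x} → x ∈ xs → x ∈ ys) → length xs ≤ length ys
unique-⊆⇒length≤ {xs = xs} {ys} unique xs⊆ys = injective⇒≤ inj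
  where
  position : Fin (length xs) → Fin (length ys)
  position i = index (xs⊆ys (∈-lookup i))
  inj : Injective _≡_ _≡_ position
  inj {i} {j} eq = lookup-injective unique i j (trans (lookup-index (xs⊆ys (∈-lookup i)))
    (trans (cong (lookup ys) eq) (sym (lookup-index (xs⊆ys (∈-lookup j))))))

length-filter-⊎ : ∀ {A : Set} {P Q R : A → Set} (P? : Decidable P) (Q? : Decidable Q) (R? : Decidable R) →
  (∀ x → P x → R x) → (∀ x → Q x → R x) → (∀ x → P x → ¬ Q x) → ∀ xs →
  length (filter P? xs) + length (filter Q? xs) ≤ length (filter R? xs)
length-filter-⊎ P? Q? R? P⊆R Q⊆R disjoint []       = z≤n
length-filter-⊎ P? Q? R? P⊆R Q⊆R disjoint (x ∷ xs)
  with ih ← length-filter-⊎ P? Q? R? P⊆R Q⊆R disjoint xs | P? x | Q? x | R? x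
... | no  _ | no  _ | no  _ = ih
... | no  _ | no  _ | yes _ = m≤n⇒m≤1+n ih
... | yes _ | no  _ | yes _ = s≤s ih
... | no  _ | yes _ | yes _ = ≤-trans (≤-reflexive (+-suc _ _)) (s≤s ih)
... | yes p | yes q | _     = contradiction q (disjoint x p)
... | yes p | no  _ | no ¬r = contradiction (P⊆R x p) ¬r
... | no  _ | yes q | no ¬r = contradiction (Q⊆R x q) ¬r

/-unique : ∀ x b ℓ .{{_ : NonZero ℓ}} → b * ℓ ≤ x → x < b * ℓ + ℓ → x / ℓ ≡ b
/-unique x b ℓ b*ℓ≤x x<b*ℓ+ℓ = ≤-antisym
  (s≤s⁻¹ (m<n*o⇒m/o<n (subst (x <_) (+-comm (b * ℓ) ℓ) x<b*ℓ+ℓ)))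
  (≤-trans (≤-reflexive (sym (m*n/n≡m b ℓ))) (/-monoˡ-≤ ℓ b*ℓ≤x))

-- (k , b , side) stands for the pairs (x , x + ℓ) with ℓ = 1 + k and x / ℓ = b, all of which agree
-- in a square of period ℓ at position b ℓ. Each such block is counted once for each endpoint of a pair.
Block : Set
Block = ℕ × ℕ × Bool

_≟ᴮ_ : DecidableEquality Block
_≟ᴮ_ = ×-≡-dec _≟_ (×-≡-dec _≟_ _≟ᵇ_)

sides : List Bool
sides = false ∷ true ∷ []

layer : ℕ → ℕ → List Block
layer n k = map (k ,_) (cartesianProduct (upTo (blockCount n k)) sides)

blocks : ℕ → ℕ → List Block
blocks n zero    = []
blocks n (suc L) = layer n L ++ blocks n L

length-×-sides : ∀ (bs : List ℕ) → length (cartesianProduct bs sides) ≡ length bs * 2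
length-×-sides []       = refl
length-×-sides (_ ∷ bs) = cong (2 +_) (length-×-sides bs)

length-blocks : ∀ n L → length (blocks n L) ≡ Σ[ℓ< L ] (blockCount n) * 2
length-blocks n zero    = refl
length-blocks n (suc L) = begin
  length (layer n L ++ blocks n L)              ≡⟨ length-++ (layer n L) ⟩
  length (layer n L) + length (blocks n L)      ≡⟨ cong₂ _+_ length-layer (length-blocks n L) ⟩
  blockCount n L * 2 + N * 2                    ≡⟨ *-distribʳ-+ 2 (blockCount n L) N ⟨
  (blockCount n L + N) * 2                      ≡⟨ cong (_* 2) (+-comm (blockCount n L) N) ⟩
  (N + blockCount n L) * 2                      ∎
  where
  open ≡-Reasoning
  N = Σ[ℓ< L ] (blockCount n)
  length-layer : length (layer n L) ≡ blockCount n L * 2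
  length-layer = trans (length-map _ (cartesianProduct (upTo (blockCount n L)) sides))
    (trans (length-×-sides (upTo (blockCount n L))) (cong (_* 2) (length-upTo (blockCount n L))))

∈-layer⁻ : ∀ {n L k b side} → (k , b , side) ∈ layer n L → k ≡ L × b < blockCount n L
∈-layer⁻ {n} {L} ∈layer with (b , side) , ∈× , refl ← ∈-map⁻ (L ,_) ∈layer =
  refl , ∈-upTo⁻ (proj₁ (∈-cartesianProduct⁻ (upTo (blockCount n L)) sides ∈×))

∈-blocks⁻ : ∀ {n} L {k b side} → (k , b , side) ∈ blocks n L → k < L × b < blockCount n k
∈-blocks⁻ {n} (suc L) ∈blocks with ∈-++⁻ (layer n L) ∈blocks
... | inj₁ ∈layer with refl , b< ← ∈-layer⁻ {n} {L} ∈layer = ≤-refl , b<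
... | inj₂ ∈rest with k< , b< ← ∈-blocks⁻ L ∈rest = m≤n⇒m≤1+n k< , b<

blocks-unique : ∀ n L → Unique (blocks n L)
blocks-unique n zero    = []
blocks-unique n (suc L) = Unique.++⁺
  (Unique.map⁺ ,-injectiveʳ (Unique.cartesianProduct⁺ (Unique.upTo⁺ (blockCount n L)) sides-unique))
  (blocks-unique n L)
  λ { {k , b , side} (∈layer , ∈rest) →
      <-irrefl (proj₁ (∈-layer⁻ {n} {L} ∈layer)) (proj₁ (∈-blocks⁻ L ∈rest)) }
  where
  sides-unique : Unique sides
  sides-unique = ((λ ()) All.∷ All.[]) ∷ All.[] ∷ []

-- The symbols c with c % 4 = a are reserved for the positions where word is a.
module _ (word : ℕ → ℕ) (word<4 : ∀ i → word i < 4) (σ d : ℕ) (4[1+d]≤σ : 4 * suc d ≤ σ) where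

  open Adversary σ

  group : Fin σ → ℕ
  group c = toℕ c % 4

  private module _ (x : ℕ) where

    -- The symbols word x + 4 j with j ≤ d lie in the group of `x`: one more than the `d` colours
    -- that can be forbidden.
    member< : ∀ (j : Fin (suc d)) → word x + toℕ j * 4 < σ
    member< j = <-≤-trans (+-monoˡ-< (toℕ j * 4) (word<4 x))
      (≤-trans (*-monoˡ-≤ 4 (toℕ<n j)) (≤-trans (≤-reflexive (*-comm (suc d) 4)) 4[1+d]≤σ))

    member : Fin (suc d) → Fin σ
    member j = fromℕ< (member< j)

    toℕ-member : ∀ j → toℕ (member j) ≡ word x + toℕ j * 4
    toℕ-member j = toℕ-fromℕ< (member< j)

    member-injective : ∀ {i j} → member i ≡ member j → i ≡ j
    member-injective {i} {j} eq = toℕ-injective (*-cancelʳ-≡ (toℕ i) (toℕ j) 4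
      (+-cancelˡ-≡ (word x) _ _
        (trans (sym (toℕ-member i)) (trans (cong toℕ eq) (toℕ-member j)))))

    group-member : ∀ j → group (member j) ≡ word x
    group-member j = begin
      toℕ (member j) % 4             ≡⟨ cong (_% 4) (toℕ-member j) ⟩
      (word x + toℕ j * 4) % 4     ≡⟨ [m+kn]%n≡m%n (word x) (toℕ j) 4 ⟩
      word x % 4                   ≡⟨ m<n⇒m%n≡m (word<4 x) ⟩
      word x                       ∎
      where open ≡-Reasoning

  fresh-in-group : Choice (λ _ → d) (λ x c → group c ≡ word x)
  fresh-in-group x F F≤d
    with j , ∉F ← fresh _≟ᶜ_ (inj₁ ∘ member x) (member-injective x ∘ inj₁-injective) F (s≤s F≤d) =
    member x j , ∉F , group-member x j

-- Completions with and without a square, and the charging of block pairs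

module LowerBound (word : ℕ → ℕ)
  (word-squareFree : ∀ s p → 0 < p → ¬ (∀ k → k < p → word (k + s) ≡ word (k + s + p)))
  (n σ L : ℕ) (4[1+4L]≤σ : 4 * suc (4 * L) ≤ σ) (group : Fin σ → ℕ)
  (fresh-in-group : Adversary.Choice σ (λ _ → 4 * L) (λ x c → group c ≡ word x)) where

  open Adversary σ

  d : ℕ
  d = 4 * L

  open Play n d group word fresh-in-group
  open Valid

  fresh-colour : ∀ {bound} → (∀ v → bound v < σ) → Choice bound (λ _ _ → ⊤)
  fresh-colour bound<σ v F F≤ with c , ∉F ← fresh _≟ᶜ_ inj₁ inj₁-injective F (≤-<-trans F≤ (bound<σ v)) =
    c , ∉F , tt

  -- Applying `group` letter by letter would turn a square of the string into a square of `word`.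
  grouped⇒squareFree : ∀ τ → (∀ x → group (τ x) ≡ word x) → SquareFree (toList (string τ))
  grouped⇒squareFree τ group-τ sq =
    let s , p , 0<p , periodic = hasSquare⇒periodic τ n (subst HasSquare (toList-tabulate τ n) sq) in
    word-squareFree s p 0<p λ k k<p →
      trans (sym (group-τ (k + s))) (trans (cong group (periodic k k<p)) (group-τ (k + s + p)))

  module _ {χ : Colouring} {H : Edges} (V : Valid χ H) where

    group-completion : ∀ f → (∀ x → group (f x) ≡ word x) → ∀ x → group ([ id , f ]′ (χ x)) ≡ word x
    group-completion f group-f x with shape V x
    ... | inj₁ χx≡ = trans (cong (group ∘ [ id , f ]′) χx≡) (group-f x)
    ... | inj₂ (c , χx≡ , c-group) = trans (cong (group ∘ [ id , f ]′) χx≡) c-group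

    squareFree-realization : ∃ λ τ → Realizes τ χ H × SquareFree (toList (string τ))
    squareFree-realization =
      let f , f-group , realizes = completion in
      [ id , f ]′ ∘ χ , realizes , grouped⇒squareFree ([ id , f ]′ ∘ χ) (group-completion f f-group)
      where
      completion : ∃ λ (f : ℕ → Fin σ) → (∀ x → group (f x) ≡ word x) × Realizes ([ id , f ]′ ∘ χ) χ H
      completion = complete (proper V) (symm V) (range V)
        (λ x v x<n eq → subst (_< n) (shape-inj₂ V x eq) x<n)
        {Q = λ x c → group c ≡ word x}
        (λ v F F≤ → fresh-in-group v F (≤-trans F≤ (sparse V v)))

    module _ (s ℓ : ℕ) (0<ℓ : 0 < ℓ) (s+2ℓ≤n : s + ℓ + ℓ ≤ n)
             (uncommitted : ∀ x → s ≤ x → x < s + ℓ + ℓ → χ x ≡ inj₂ x)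
             (non-adjacent : ∀ x → s ≤ x → x < s + ℓ → (x , x + ℓ) ∉ H) where

      private
        Upper : ℕ → Set
        Upper y = s + ℓ ≤ y × y < s + ℓ + ℓ

        upper? : Decidable Upper
        upper? y = (s + ℓ ≤? y) ×-dec (y <? s + ℓ + ℓ)

        -- Each position of the second block takes the colour of its partner in the first.
        merged : Colouring
        merged y with upper? y
        ... | yes _ = inj₂ (y ∸ ℓ)
        ... | no  _ = χ y

        lower≤ : ∀ {y} → Upper y → ℓ ≤ y
        lower≤ (≤y , _) = ≤-trans (m≤n+m ℓ s) ≤y

        uncommitted-upper : ∀ {y} → Upper y → χ y ≡ inj₂ y
        uncommitted-upper {y} (≤y , y<) = uncommitted y (≤-trans (m≤m+n s ℓ) ≤y) y<

        -- Before merging, a - ℓ was alone in its class, so such an edge would be a compared pair at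
        -- distance ℓ.
        shifted-edge : ∀ {a b} → Upper a → (b , a) ∈ H → χ b ≢ inj₂ (a ∸ ℓ)
        shifted-edge {a} {b} up ba∈H χb≡ with refl ← shape-inj₂ V b χb≡ =
          non-adjacent (a ∸ ℓ) (m+n≤o⇒m≤o∸n s (proj₁ up))
            (+-cancelʳ-< ℓ (a ∸ ℓ) (s + ℓ) (subst (_< s + ℓ + ℓ) (sym (m∸n+n≡m (lower≤ up))) (proj₂ up)))
            (subst (λ z → (a ∸ ℓ , z) ∈ H) (sym (m∸n+n≡m (lower≤ up))) ba∈H)

        merged-proper : Proper merged H
        merged-proper {a} {b} ab∈H eq with upper? a | upper? b
        ... | yes up-a | yes up-b = proper V ab∈H
                (cong χ (∸-cancelʳ-≡ (lower≤ up-a) (lower≤ up-b) (inj₂-injective eq)))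
        ... | yes up-a | no  _    = shifted-edge up-a (symm V ab∈H) (sym eq)
        ... | no  _    | yes up-b = shifted-edge up-b ab∈H eq
        ... | no  _    | no  _    = proper V ab∈H eq

        merged-class<n : ∀ x v → x < n → merged x ≡ inj₂ v → v < n
        merged-class<n x v x<n eq with upper? x
        ... | yes _ with refl ← eq = ≤-<-trans (m∸n≤m x ℓ) x<n
        ... | no  _ = subst (_< n) (shape-inj₂ V x eq) x<n

        merged-class : ∀ v x → merged x ≡ inj₂ v → χ x ≡ inj₂ v ⊎ χ x ≡ inj₂ (v + ℓ)
        merged-class v x eq with upper? x
        ... | no  _  = inj₁ eq
        ... | yes up with refl ← eq =
          inj₂ (trans (uncommitted-upper up) (cong inj₂ (sym (m∸n+n≡m (lower≤ up)))))

        merged-degree<σ : ∀ v → classDegree merged H v < σ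
        merged-degree<σ v = begin-strict
          classDegree merged H v
            ≤⟨ length-filter-∪ (inClass? merged v) (inClass? χ v) (inClass? χ (v + ℓ))
                 (λ e → merged-class v (proj₁ e)) H ⟩
          classDegree χ H v + classDegree χ H (v + ℓ) ≤⟨ +-mono-≤ (sparse V v) (sparse V (v + ℓ)) ⟩
          d + d                                       <⟨ n<1+n (d + d) ⟩
          suc (d + d)                                 ≤⟨ m≤m+n (suc (d + d)) (3 + d + d) ⟩
          suc (d + d) + (3 + d + d)                   ≡⟨ quadruple d ⟩
          4 * suc d                                   ≤⟨ 4[1+4L]≤σ ⟩
          σ                                           ∎
          where
          open ≤-Reasoning
          quadruple : ∀ d → suc (d + d) + (3 + d + d) ≡ 4 * suc d
          quadruple = solve-∀

        merged-lower : ∀ x → s ≤ x → x < s + ℓ → merged x ≡ inj₂ x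
        merged-lower x s≤x x<s+ℓ with upper? x
        ... | yes (≤x , _) = contradiction ≤x (<⇒≱ x<s+ℓ)
        ... | no  _        = uncommitted x s≤x (<-≤-trans x<s+ℓ (m≤m+n (s + ℓ) ℓ))

        merged-upper : ∀ x → s ≤ x → x < s + ℓ → merged (x + ℓ) ≡ inj₂ x
        merged-upper x s≤x x<s+ℓ with upper? (x + ℓ)
        ... | yes _  = cong inj₂ (m+n∸n≡m x ℓ)
        ... | no ¬up = contradiction (+-monoˡ-≤ ℓ s≤x , +-monoˡ-< ℓ x<s+ℓ) ¬up

        merged-keeps : ∀ x {c} → χ x ≡ inj₁ c → merged x ≡ inj₁ c
        merged-keeps x eq with upper? x
        ... | no  _  = eq
        ... | yes up with () ← trans (sym eq) (uncommitted-upper up)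

      square-realization : ∃ λ τ → Realizes τ χ H × HasSquare (toList (string τ))
      square-realization =
        τ , ((λ x c eq → proj₁ realizes x c (merged-keeps x eq)) , proj₂ realizes) ,
        subst HasSquare (sym (toList-tabulate τ n)) (periodic⇒hasSquare τ s ℓ 0<ℓ s+2ℓ≤n λ k k<ℓ →
          cong [ id , f ]′ (trans (merged-lower (s + k) (m≤m+n s k) (+-monoʳ-< s k<ℓ))
                                  (sym (merged-upper (s + k) (m≤m+n s k) (+-monoʳ-< s k<ℓ)))))
        where
        completion : ∃ λ (f : ℕ → Fin σ) → (ℕ → ⊤) × Realizes ([ id , f ]′ ∘ merged) merged H
        completion = complete merged-proper (symm V) (range V) merged-class<n (fresh-colour merged-degree<σ)
        f τ : ℕ → Fin σ
        f = proj₁ completion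
        τ = [ id , f ]′ ∘ merged
        realizes : Realizes τ merged H
        realizes = proj₂ (proj₂ completion)

  -- For each length, `x` can lie in the first or in the second block of a pair. With both sides
  -- this makes four entries, hence d = 4 L in all.
  blocksAt : ℕ → ℕ → List Block
  blocksAt x zero    = []
  blocksAt x (suc L) = (L , x / suc L , false) ∷ (L , x / suc L , true) ∷
                       -- If x / ℓ = 0, the truncated subtraction merely repeats block 0.
                       (L , x / suc L ∸ 1 , false) ∷ (L , x / suc L ∸ 1 , true) ∷ blocksAt x L

  length-blocksAt : ∀ x L → length (blocksAt x L) ≡ L * 4
  length-blocksAt x zero    = refl
  length-blocksAt x (suc L) = cong (4 +_) (length-blocksAt x L)

  ∈-blocksAt : ∀ {L k x b} → k < L → x / suc k ≡ b ⊎ x / suc k ≡ suc b → ∀ side → (k , b , side) ∈ blocksAt x L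
  ∈-blocksAt {suc L} k<1+L x/ℓ side with m≤n⇒m<n∨m≡n (s≤s⁻¹ k<1+L)
  ... | inj₁ k<L = there (there (there (there (∈-blocksAt k<L x/ℓ side))))
  ∈-blocksAt (s≤s _) (inj₁ refl) false | inj₂ refl = here refl
  ∈-blocksAt (s≤s _) (inj₁ refl) true  | inj₂ refl = there (here refl)
  ∈-blocksAt (s≤s _) (inj₂ eq)   false | inj₂ refl rewrite eq = there (there (here refl))
  ∈-blocksAt (s≤s _) (inj₂ eq)   true  | inj₂ refl rewrite eq = there (there (there (here refl)))

  -- An edge claims the block of its lower endpoint, with ℓ the distance of its ends. The two
  -- orientations of a comparison claim the two sides.
  edgeBlock : ℕ × ℕ → Block
  edgeBlock (a , b) with a <? b
  ... | yes _ = b ∸ a ∸ 1 , a / suc (b ∸ a ∸ 1) , false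
  ... | no  _ = a ∸ b ∸ 1 , b / suc (a ∸ b ∸ 1) , true

  edgeBlock-< : ∀ x k → edgeBlock (x , x + suc k) ≡ (k , x / suc k , false)
  edgeBlock-< x k with x <? x + suc k
  ... | yes _ rewrite m+n∸m≡n x (suc k) = refl
  ... | no x≮ = contradiction (m<m+n x (s≤s z≤n)) x≮

  edgeBlock-> : ∀ x k → edgeBlock (x + suc k , x) ≡ (k , x / suc k , true)
  edgeBlock-> x k with x + suc k <? x
  ... | yes x+ℓ<x = contradiction (m≤m+n x (suc k)) (<⇒≱ x+ℓ<x)
  ... | no  _ rewrite m+n∸m≡n x (suc k) = refl

  module _ (χ : Colouring) (H : Edges) where

    -- A committed position trades the claims of its own edges for all blocks it can spoil. Either
    -- way it claims no more than its degree.
    tokens : ℕ → List Block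
    tokens x with χ x
    ... | inj₁ _ = blocksAt x L
    ... | inj₂ _ = map edgeBlock (filter (from? x) H)

    allTokens : ℕ → List Block
    allTokens zero    = []
    allTokens (suc m) = tokens m ++ allTokens m

    tokens⊆allTokens : ∀ {x m β} → x < m → β ∈ tokens x → β ∈ allTokens m
    tokens⊆allTokens {x} {suc m} x<1+m β∈ with m≤n⇒m<n∨m≡n (s≤s⁻¹ x<1+m)
    ... | inj₁ x<m  = ∈-++⁺ʳ (tokens m) (tokens⊆allTokens x<m β∈)
    ... | inj₂ refl = ∈-++⁺ˡ β∈

    committed-token : ∀ {x c β} → χ x ≡ inj₁ c → β ∈ blocksAt x L → β ∈ tokens x
    committed-token {x} χx≡ β∈ rewrite χx≡ = β∈

    edge-token : ∀ {x v y} → χ x ≡ inj₂ v → (x , y) ∈ H → edgeBlock (x , y) ∈ tokens x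
    edge-token {x} χx≡ xy∈H rewrite χx≡ = ∈-map⁺ edgeBlock (∈-filter⁺ (from? x) xy∈H refl)

  module _ {χ : Colouring} {H : Edges} (V : Valid χ H) where

    length-tokens : ∀ x → length (tokens χ H x) ≤ degree H x
    length-tokens x with χ x in χx≡
    ... | inj₁ c = ≤-trans (≤-reflexive (trans (length-blocksAt x L) (*-comm L 4))) (saturated V x χx≡)
    ... | inj₂ _ = ≤-reflexive (length-map edgeBlock (filter (from? x) H))

    -- The entries of `H` are sorted by first endpoint, so the degrees of distinct positions count
    -- disjoint parts of `H`.
    length-allTokens : ∀ m → length (allTokens χ H m) ≤ length H
    length-allTokens m = ≤-trans (below m) (length-filter (below? m) H)
      where
      below? : ∀ m → Decidable (λ (e : ℕ × ℕ) → proj₁ e < m)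
      below? m e = proj₁ e <? m
      below : ∀ m → length (allTokens χ H m) ≤ length (filter (below? m) H)
      below zero    = z≤n
      below (suc m) = ≤-trans (≤-reflexive (length-++ (tokens χ H m)))
        (≤-trans (+-mono-≤ (length-tokens m) (below m))
          (length-filter-⊎ (from? m) (below? m) (below? (suc m))
            (λ e eq → s≤s (≤-reflexive eq)) (λ e → m≤n⇒m≤1+n) (λ e eq → <-irrefl eq) H))

    -- One unclaimed side is enough: a committed position claims both sides, and a compared pair
    -- claims each side from one of its ends.
    unclaimed⇒square : ∀ {k b side} → k < L → b < blockCount n k → (k , b , side) ∉ allTokens χ H n →
      ∃ λ τ → Realizes τ χ H × HasSquare (toList (string τ))
    unclaimed⇒square {k} {b} {side} k<L b< β∉ =
      square-realization V s ℓ (s≤s z≤n) s+2ℓ≤n uncommitted (non-adjacent side refl)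
      where
      ℓ = suc k
      s = b * ℓ
      s+2ℓ≤n : s + ℓ + ℓ ≤ n
      s+2ℓ≤n = begin
        b * ℓ + ℓ + ℓ        ≡⟨ rearrange b ℓ ⟩
        -- From b < n/ℓ - 1 it follows that b + 2 ≤ n/ℓ, so the second block fits as well.
        (suc b + 1) * ℓ      ≤⟨ *-monoˡ-≤ ℓ (m≤o∸n⇒m+n≤o (suc b) (≢0⇒1≤ (n / ℓ) b<) b<) ⟩
        n / ℓ * ℓ            ≤⟨ m/n*n≤m n ℓ ⟩
        n                    ∎
        where
        open ≤-Reasoning
        rearrange : ∀ b ℓ → b * ℓ + ℓ + ℓ ≡ (suc b + 1) * ℓ
        rearrange = solve-∀
        ≢0⇒1≤ : ∀ q → b < q ∸ 1 → 1 ≤ q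
        ≢0⇒1≤ (suc q) _ = s≤s z≤n
      quotient : ∀ x → s ≤ x → x < s + ℓ + ℓ → x / ℓ ≡ b ⊎ x / ℓ ≡ suc b
      quotient x s≤x x< with x <? s + ℓ
      ... | yes x<s+ℓ = inj₁ (/-unique x b ℓ s≤x x<s+ℓ)
      ... | no  x≮s+ℓ = inj₂ (/-unique x (suc b) ℓ
              (subst (_≤ x) (+-comm s ℓ) (≮⇒≥ x≮s+ℓ)) (subst (λ z → x < z + ℓ) (+-comm s ℓ) x<))
      uncommitted : ∀ x → s ≤ x → x < s + ℓ + ℓ → χ x ≡ inj₂ x
      uncommitted x s≤x x< with shape V x
      ... | inj₁ χx≡ = χx≡
      ... | inj₂ (c , χx≡ , _) = contradiction
        (tokens⊆allTokens χ H (<-≤-trans x< s+2ℓ≤n)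
          (committed-token χ H χx≡ (∈-blocksAt k<L (quotient x s≤x x<) side))) β∉
      -- The side selects the endpoint that would hold the claim: the lower for `false`, the upper
      -- for `true`.
      non-adjacent : ∀ side′ → side′ ≡ side → ∀ x → s ≤ x → x < s + ℓ → (x , x + ℓ) ∉ H
      non-adjacent false refl x s≤x x<s+ℓ e∈H = β∉ (tokens⊆allTokens χ H (range V e∈H)
        (subst (_∈ tokens χ H x)
          (trans (edgeBlock-< x k) (cong (λ q → k , q , false) (/-unique x b ℓ s≤x x<s+ℓ)))
          (edge-token χ H (uncommitted x s≤x (<-≤-trans x<s+ℓ (m≤m+n (s + ℓ) ℓ))) e∈H)))
      non-adjacent true refl x s≤x x<s+ℓ e∈H = β∉ (tokens⊆allTokens χ H (range V (symm V e∈H))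
        (subst (_∈ tokens χ H (x + ℓ))
          (trans (edgeBlock-> x k) (cong (λ q → k , q , true) (/-unique x b ℓ s≤x x<s+ℓ)))
          (edge-token χ H (uncommitted (x + ℓ) (≤-trans s≤x (m≤m+n x ℓ)) (+-monoˡ-< ℓ x<s+ℓ)) (symm V e∈H))))

  -- The square-free realization forces the answer `b` to be `true`, and an unclaimed block would
  -- give a string with a square on the same path. So the 2 N distinct blocks are all claimed by at
  -- most 2 `depth D` entries.
  comparisons-lower-bound : (D : DecTree n) → DecidesSquareFreeness n σ D →
    Σ[ℓ< L ] (blockCount n) ≤ depth D
  comparisons-lower-bound D decides
    with χ , H , b , V , H≤ , replay ← adversary D initial = *-cancelʳ-≤ N (depth D) 2 (begin
      N * 2                        ≡⟨ length-blocks n L ⟨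
      length (blocks n L)          ≤⟨ unique-⊆⇒length≤ (blocks-unique n L) claimed ⟩
      length (allTokens χ H n)     ≤⟨ length-allTokens V n ⟩
      length H                     ≤⟨ H≤ ⟩
      2 * depth D + 0              ≡⟨ trans (+-identityʳ (2 * depth D)) (*-comm 2 (depth D)) ⟩
      depth D * 2                  ∎)
    where
    open ≤-Reasoning
    N = Σ[ℓ< L ] (blockCount n)
    b≡true : b ≡ true
    b≡true = let τ , realizes , squareFree = squareFree-realization V in
      trans (sym (proj₂ (replay τ realizes))) (Equivalence.from (decides (string τ)) squareFree)
    claimed : ∀ {β} → β ∈ blocks n L → β ∈ allTokens χ H n
    claimed {β@(k , b′ , side)} β∈ = decidable-stable (_∈?_ _≟ᴮ_ β (allTokens χ H n)) λ β∉ →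
      let k<L , b< = ∈-blocks⁻ L β∈
          τ , realizes , square = unclaimed⇒square V k<L b< β∉
      in Equivalence.to (decides (string τ)) (trans (proj₂ (replay τ realizes)) b≡true) square

theorem1 : (n σ : ℕ) → 8 ≤ σ → σ ≤ n →
    (D : DecTree n) → WithinBound n σ (depth D) →
    ¬ DecidesSquareFreeness n σ D
theorem1 n σ 8≤σ σ≤n D within decides =
  exceeds-bound n σ (depth D) L 62 ≤-refl 20≤[21/20]^62 4L≤n (≤-trans (≤-trans (s≤s z≤n) 8≤σ) σ≤n) σ<20[1+L]
    (LowerBound.comparisons-lower-bound letter letter-squareFree n σ L 4[1+4L]≤σ
      (group letter letter<4 σ (4 * L) 4[1+4L]≤σ) (fresh-in-group letter letter<4 σ (4 * L) 4[1+4L]≤σ) D decides)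
    within
  where
  open ≤-Reasoning
  -- The largest L with 16 L + 4 ≤ σ, the room for four groups of 4 L + 1 symbols. For σ < 20 it is
  -- 0: no block is counted, and n ln σ - 3.6 n is already negative.
  L = (σ ∸ 4) / 16
  4≤σ : 4 ≤ σ
  4≤σ = ≤-trans (m≤m+n 4 4) 8≤σ
  4[1+4L]≤σ : 4 * suc (4 * L) ≤ σ
  4[1+4L]≤σ = begin
    4 * suc (4 * L)     ≡⟨ rearrange L ⟩
    4 + L * 16          ≤⟨ +-monoʳ-≤ 4 (m/n*n≤m (σ ∸ 4) 16) ⟩
    4 + (σ ∸ 4)         ≡⟨ m+[n∸m]≡n 4≤σ ⟩
    σ                   ∎
    where
    rearrange : ∀ L → 4 * suc (4 * L) ≡ 4 + L * 16
    rearrange = solve-∀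
  4L≤n : 4 * L ≤ n
  4L≤n = ≤-trans (≤-trans (≤-trans (n≤1+n (4 * L)) (m≤n*m (suc (4 * L)) 4)) 4[1+4L]≤σ) σ≤n
  σ<20[1+L] : σ < 20 * suc L
  σ<20[1+L] = begin-strict
    σ                                ≡⟨ m+[n∸m]≡n 4≤σ ⟨
    4 + (σ ∸ 4)                      ≡⟨ cong (4 +_) (m≡m%n+[m/n]*n (σ ∸ 4) 16) ⟩
    4 + ((σ ∸ 4) % 16 + L * 16)      <⟨ +-monoʳ-< 4 (+-monoˡ-< (L * 16) (m%n<n (σ ∸ 4) 16)) ⟩
    20 + L * 16                      ≤⟨ +-monoʳ-≤ 20 (*-monoʳ-≤ L (m≤m+n 16 4)) ⟩
    20 + L * 20                      ≡⟨ *-comm (suc L) 20 ⟩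
    20 * suc L                       ∎
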